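{- Let $K_4-e$ be the graph obtained from the complete graph $K_4$ by removing an arbitrary edge. The multiset $M=\{(3,0),(1,2),(1,1)^2\}$ of $2$-colored degrees (where $(1,1)$ has multiplicity $2$ and the other two tuples have multiplicity $1$) is an extended profile of $\mathcal{S}(K_4-e)$. Moreover, for a host graph $G$ with ordered edges $e_1,\dots,e_m$ and maximum frontier size $w=\max_{i\in[m]}|F_i|$, there is an algorithm to construct a $3$-DD $\mathbf{Z}^{3}(\mathcal{C}_M^*)$ over $E(G)$, i.e. one representing the family of all $2$-colored subgraphs of $G$ satisfying $\mathcal{C}_M^*$, with width at most $2^{O(w\log w)}$.
   Context: All graphs are finite and simple; $[k]=\{1,\dots,k\}$; $\mathbb{N}$ is the set of non-negative integers; the number $c$ of colors is always a positive integer; $O(\cdot)$ is the usual big-O notation. Subdivisions. Subdividing an edge $\{u,v\}$ means removing it, adding a new vertex $x$ and the edges $\{u,x\},\{v,x\}$. A subdivision of $H$ is any graph obtained from $H$ by subdividing edges an arbitrary number (possibly zero) of times. $\mathcal{S}(H)$ is the family of subdivisions of $H$ (considered up to isomorphism). Colored graphs. A $c$-colored subset over a finite set $E$ is a $c$-tuple $(D_1,\dots,D_c)$ of pairwise disjoint subsets of $E$. A $c$-colored graph is a finite vertex set $U$ together with a $c$-colored subset $(D_1,\dots,D_c)$ over the set of unordered pairs of distinct elements of $U$; edges in $D_i$ have color $i$. Its underlying graph is obtained by forgetting colors; it is a $c$-colorized graph of $F$ if its underlying graph is isomorphic to $F$. A $c$-colored degree is a tuple in $\mathbb{N}^c$.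 The colored degree of a vertex $u$ is the $c$-tuple $(\delta_1,\dots,\delta_c)$ where $\delta_i$ is the number of color-$i$ edges incident to $u$. $\mathrm{DS}(F^c)$ is the multiset of colored degrees of all vertices of $F^c$. The color-$i$ subgraph of $F^c$ consists of the color-$i$ edges and their endpoints. Extended profile. Let $\Delta^c$ be the set of the $c$ tuples in $\mathbb{N}^c$ with one entry equal to $2$ and all other entries $0$. For a multiset $M$ of $c$-colored degrees, a $c$-colored graph $F^c$ satisfies $\mathcal{C}_M^*$ if and only if (a) $\mathrm{DS}(F^c)$ is obtained by adding to $M$ an arbitrary number (possibly zero) of elements of $\Delta^c$, repetitions allowed, and (b) for each $i\in[c]$ the color-$i$ subgraph of $F^c$ is connected. $M$ is an extended profile of $\mathcal{S}(H)$ if for every graph $F$: $F$ belongs to $\mathcal{S}(H)$ if and only if there exists a $c$-colorized graph $F^c$ of $F$ satisfying $\mathcal{C}_M^*$. Colored subgraphs of $G$. A $c$-colored subgraph of $G$ is identified with a $c$-colored subset $(D_1,\dots,D_c)$ over $E(G)$; it stands for the edge-induced $c$-colored graph whose vertices are the endpoints of edges in $D_1\cup\dots\cup D_c$. Frontier. The $i$-th frontier $F_i$ is the set of vertices of $G$ incident both to some edge in $\{e_1,\dots,e_{i-1}\}$ and to some edge in $\{e_i,\dots,e_m\}$. Decision diagrams. A $(c+1)$-DD over $E=\{e_1,\dots,e_m\}$ is a finite directed acyclic graph with a unique root node and two terminal nodes $\top,\bot$ (no outgoing arcs). Each non-terminal node $\alpha$ has a label $\ell(\alpha)\in[m]$ and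 exactly $c+1$ outgoing arcs, called its $0$-arc, $1$-arc, ..., $c$-arc; each arc from $\alpha$ points to a terminal node or to a non-terminal node with label $\ell(\alpha)+1$. A directed path from the root to $\top$ represents the $c$-colored subset $(B_1,\dots,B_c)$ with $B_j=\{e_{\ell(\beta)} : \text{the path uses the } j\text{ -arc of } \beta\}$. The DD represents the family of all $c$-colored subsets represented by its root-to-$\top$ paths. Its width is the maximum number of nodes with the same label. -}

module Defs where

open import Data.Bool using (Bool; true; false; T; _∧_)
open import Data.Bool.Properties using (T-∧; T?)
open import Data.Fin using (Fin; zero; suc; toℕ; _<_; _≤_; _<?_; _≤?_; _≟_)
open import Data.Fin.Properties using (any?; <-irrefl; <-asym; <-irrelevant)
open import Data.Fin.Subset using (Subset; ∣_∣; _∈_; _∪_; ⁅_⁆) renaming (⊥ to ∅)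
open import Data.Fin.Subset.Properties using (_∈?_; ∉⊥; x∈p∪q⁻; x∈⁅y⁆⇒x≡y)
open import Data.List using (List; []; _∷_; _++_; length; lookup; filter; map; allFin)
open import Data.List.Extrema.Nat using (max)
open import Data.List.Relation.Binary.Permutation.Propositional using (_↭_)
open import Data.List.Relation.Unary.All using (All)
open import Data.Nat as ℕ using (ℕ; suc; _*_)
import Data.Nat.Properties as ℕ
open import Data.Product using (Σ; ∃; ∃₂; _×_; _,_; proj₁; proj₂)
open import Data.Sum using (_⊎_; inj₁; inj₂)
open import Data.Unit using (tt)
open import Data.Vec using (Vec; []; _∷_; replicate; tabulate; _[_]≔_)
open import Function.Base using (_∘_; id)
open import Function.Bundles using (_↔_; _⇔_; module Inverse; module Equivalence; module Injection)
open import Function.Properties.Inverse using (↔⇒↣)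
open import Relation.Binary.Construct.Closure.ReflexiveTransitive using (Star)
open import Relation.Binary.PropositionalEquality
open import Relation.Nullary using (¬_; Dec; yes; no; contradiction)
open import Relation.Nullary.Decidable using (⌊_⌋; toWitness; fromWitness; _×-dec_; _⊎-dec_; ¬?)

record Graph : Set where
  field
    order  : ℕ
    adj    : Fin order → Fin order → Bool
    irrefl : ∀ u → ¬ T (adj u u)
    symm   : ∀ u v → T (adj u v) → T (adj v u)

  Vertex : Set
  Vertex = Fin order

  Adj : Vertex → Vertex → Set
  Adj u v = T (adj u v)

open Graph public using (Vertex; Adj)

infix 4 _≅_

record _≅_ (F H : Graph) : Set where
  field
    bijection : Vertex F ↔ Vertex H
  open Inverse bijection public using (to; from)
  field
    adj-preserved : ∀ u v → Adj F u v ⇔ Adj H (to u) (to v)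

-- {u , v} and {x , y} are the same unordered pair.
SameEnds : ∀ {n} (u v x y : Fin n) → Set
SameEnds u v x y = (x ≡ u × y ≡ v) ⊎ (x ≡ v × y ≡ u)

sameEnds? : ∀ {n} (u v x y : Fin n) → Dec (SameEnds u v x y)
sameEnds? u v x y = (x ≟ u ×-dec y ≟ v) ⊎-dec (x ≟ v ×-dec y ≟ u)

sameEnds-sym : ∀ {n} {u v x y : Fin n} → SameEnds u v x y → SameEnds u v y x
sameEnds-sym (inj₁ (p , q)) = inj₂ (q , p)
sameEnds-sym (inj₂ (p , q)) = inj₁ (q , p)

complete : ℕ → Graph
complete n = record
  { order  = n
  ; adj    = λ u v → ⌊ ¬? (u ≟ v) ⌋
  ; irrefl = λ u p → toWitness p refl
  ; symm   = λ u v p → fromWitness (toWitness p ∘ sym)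
  }

module _ (F : Graph) (u v : Vertex F) where
  open Graph F using (order; adj; irrefl; symm)

  deleteEdge : Graph
  deleteEdge = record
    { order  = order
    ; adj    = λ x y → adj x y ∧ ⌊ ¬? (sameEnds? u v x y) ⌋
    ; irrefl = λ x p → irrefl x (proj₁ (Equivalence.to T-∧ p))
    ; symm   = λ x y p → let a , q = Equivalence.to T-∧ p in
        Equivalence.from T-∧ (symm x y a , fromWitness (toWitness q ∘ sameEnds-sym))
    }

  -- The new vertex is zero; an old vertex x becomes suc x.
  subdivideEdge : Graph
  subdivideEdge = record
    { order  = suc order
    ; adj    = adj′
    ; irrefl = λ { zero () ; (suc x) → Graph.irrefl deleteEdge x }
    ; symm   = λ { zero zero () ; zero (suc y) → id ; (suc x) zero → id
                 ; (suc x) (suc y) → Graph.symm deleteEdge x y }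
    }
    where
    isEnd : Vertex F → Bool
    isEnd x = ⌊ x ≟ u ⊎-dec x ≟ v ⌋

    adj′ : Fin (suc order) → Fin (suc order) → Bool
    adj′ zero    zero    = false
    adj′ zero    (suc y) = isEnd y
    adj′ (suc x) zero    = isEnd x
    adj′ (suc x) (suc y) = Graph.adj deleteEdge x y

data 𝒮 (H : Graph) : Graph → Set where
  base      : ∀ {F} → H ≅ F → 𝒮 H F
  subdivide : ∀ {F F′} → 𝒮 H F → (u v : Vertex F) → Adj F u v →
              subdivideEdge F u v ≅ F′ → 𝒮 H F′

-- edge i u v holds iff {u , v} ∈ Dᵢ.
record ColouredGraph (c : ℕ) : Set where
  field
    order    : ℕ
    edge     : Fin c → Fin order → Fin order → Bool
    irrefl   : ∀ i u → ¬ T (edge i u u)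
    symm     : ∀ i u v → T (edge i u v) → T (edge i v u)
    disjoint : ∀ i j u v → T (edge i u v) → T (edge j u v) → i ≡ j

module _ {c : ℕ} (Fᶜ : ColouredGraph c) where
  open ColouredGraph Fᶜ

  underlying : Graph
  underlying = record
    { order  = order
    ; adj    = λ u v → ⌊ any? (λ i → T? (edge i u v)) ⌋
    ; irrefl = λ u p → let i , e = toWitness p in irrefl i u e
    ; symm   = λ u v p → let i , e = toWitness p in fromWitness (i , symm i u v e)
    }

  colouredDegree : Fin order → Vec ℕ c
  colouredDegree u = tabulate λ i → ∣ tabulate (edge i u) ∣

  DS : List (Vec ℕ c)
  DS = map colouredDegree (allFin order)

  -- The colour-i subgraph is connected.  Its vertices are the endpoints of the
  -- colour-i edges; if there are none, it counts as connected.
  ColourConnected : Fin c → Set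
  ColourConnected i = ∀ u v → ∃ (T ∘ edge i u) → ∃ (T ∘ edge i v) →
                      Star (λ x y → T (edge i x y)) u v

  edgeInduced : ColouredGraph c
  edgeInduced = record
    { order    = length endpoints
    ; edge     = λ i p q → edge i (lookup endpoints p) (lookup endpoints q)
    ; irrefl   = λ i p → irrefl i (lookup endpoints p)
    ; symm     = λ i p q → symm i (lookup endpoints p) (lookup endpoints q)
    ; disjoint = λ i j p q → disjoint i j (lookup endpoints p) (lookup endpoints q)
    }
    where
    endpoints : List (Fin order)
    endpoints = filter (λ u → any? λ i → any? λ v → T? (edge i u v)) (allFin order)

_IsColourizedGraphOf_ : ∀ {c} → ColouredGraph c → Graph → Set
Fᶜ IsColourizedGraphOf F = underlying Fᶜ ≅ F

Δ : ∀ c → Vec ℕ c → Set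
Δ c d = ∃ λ (i : Fin c) → d ≡ replicate c 0 [ i ]≔ 2

-- Multisets of coloured degrees are lists up to permutation.
record 𝒞* {c} (M : List (Vec ℕ c)) (Fᶜ : ColouredGraph c) : Set where
  field
    degrees   : ∃ λ A → All (Δ c) A × DS Fᶜ ↭ M ++ A
    connected : ∀ i → ColourConnected Fᶜ i

IsExtendedProfile : ∀ {c} → List (Vec ℕ c) → (Graph → Set) → Set
IsExtendedProfile {c} M 𝓕 =
  ∀ F → 𝓕 F ⇔ ∃ λ (Fᶜ : ColouredGraph c) → Fᶜ IsColourizedGraphOf F × 𝒞* M Fᶜ

-- Each edge occurs exactly once, with its smaller endpoint first.
Edge : Graph → Set
Edge G = Σ (Vertex G × Vertex G) λ (u , v) → u < v × Adj G u v

EdgeOrder : Graph → ℕ → Set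
EdgeOrder G m = Fin m ↔ Edge G

record ColouredSubset (c m : ℕ) : Set where
  field
    part     : Fin c → Subset m
    disjoint : ∀ {i j x} → x ∈ part i → x ∈ part j → i ≡ j

module _ (G : Graph) {m : ℕ} (e : EdgeOrder G m) where
  private
    src tgt : Fin m → Vertex G
    src k = proj₁ (proj₁ (Inverse.to e k))
    tgt k = proj₂ (proj₁ (Inverse.to e k))

    src<tgt : ∀ k → src k < tgt k
    src<tgt k = proj₁ (proj₂ (Inverse.to e k))

  Incident : Vertex G → Fin m → Set
  Incident v k = v ≡ src k ⊎ v ≡ tgt k

  incident? : ∀ v k → Dec (Incident v k)
  incident? v k = v ≟ src k ⊎-dec v ≟ tgt k

  Joins : Fin m → Vertex G → Vertex G → Set
  Joins k = SameEnds (src k) (tgt k)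

  joins? : ∀ k u v → Dec (Joins k u v)
  joins? k = sameEnds? (src k) (tgt k)

  joins-irrefl : ∀ k u → ¬ Joins k u u
  joins-irrefl k u (inj₁ (p , q)) = <-irrefl (trans (sym p) q) (src<tgt k)
  joins-irrefl k u (inj₂ (p , q)) = <-irrefl (trans (sym q) p) (src<tgt k)

  joins-injective : ∀ k l u v → Joins k u v → Joins l u v → k ≡ l
  joins-injective k l u v p q =
    Injection.injective (↔⇒↣ e) (edge-≡ (Inverse.to e k) (Inverse.to e l) (ends p q))
    where
    swapped : src k ≡ tgt l → tgt k ≡ src l → src k ≡ src l × tgt k ≡ tgt l
    swapped s t = contradiction (src<tgt l)
      (<-asym (subst₂ _<_ s t (src<tgt k)))

    ends : Joins k u v → Joins l u v → src k ≡ src l × tgt k ≡ tgt l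
    ends (inj₁ (a , b)) (inj₁ (a′ , b′)) = trans (sym a) a′ , trans (sym b) b′
    ends (inj₁ (a , b)) (inj₂ (a′ , b′)) = swapped (trans (sym a) a′) (trans (sym b) b′)
    ends (inj₂ (a , b)) (inj₁ (a′ , b′)) = swapped (trans (sym b) b′) (trans (sym a) a′)
    ends (inj₂ (a , b)) (inj₂ (a′ , b′)) = trans (sym b) b′ , trans (sym a) a′

    T-irrelevant : ∀ {b} (s t : T b) → s ≡ t
    T-irrelevant {true} tt tt = refl

    edge-≡ : (x y : Edge G) →
             proj₁ (proj₁ x) ≡ proj₁ (proj₁ y) × proj₂ (proj₁ x) ≡ proj₂ (proj₁ y) → x ≡ y
    edge-≡ ((s , t) , l , a) ((_ , _) , l′ , a′) (refl , refl) =
      cong ((s , t) ,_) (cong₂ _,_ (<-irrelevant l l′) (T-irrelevant a a′))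

  colouredSubgraph : ∀ {c} → ColouredSubset c m → ColouredGraph c
  colouredSubgraph {c} D = edgeInduced record
    { order    = Graph.order G
    ; edge     = λ i u v → ⌊ edge? i u v ⌋
    ; irrefl   = λ i u p → let k , _ , q = toWitness {a? = edge? i u u} p in joins-irrefl k u q
    ; symm     = λ i u v p → let k , d , q = toWitness {a? = edge? i u v} p in
        fromWitness {a? = edge? i v u} (k , d , sameEnds-sym q)
    ; disjoint = λ i j u v p q →
        let k , d , s = toWitness {a? = edge? i u v} p
            l , d′ , t = toWitness {a? = edge? j u v} q
        in disjoint (subst (_∈ part i) (joins-injective k l u v s t) d) d′
    }
    where
    open ColouredSubset D
    edge? : ∀ i u v → Dec (∃ λ k → k ∈ part i × Joins k u v)
    edge? i u v = any? λ k → k ∈? part i ×-dec joins? k u v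

  frontier : Fin m → Subset (Graph.order G)
  frontier i = tabulate λ v →
    ⌊ any? (λ j → j <? i ×-dec incident? v j) ×-dec any? (λ j → i ≤? j ×-dec incident? v j) ⌋

  maxFrontierSize : ℕ
  maxFrontierSize = max 0 (map (∣_∣ ∘ frontier) (allFin m))

data Node (N : ℕ) : Set where
  ⊤ₙ ⊥ₙ : Node N
  inner  : Fin N → Node N

-- Edges are numbered from 0, so edge eᵢ₊₁ is i : Fin m.  The 0-arc of α is
-- arc α zero and its (j+1)-arc, for the j-th colour, is arc α (suc j).
-- Acyclicity follows from arc-label.
record DD (c m : ℕ) : Set where
  field
    size      : ℕ
    label     : Fin size → Fin m
    arc       : Fin size → Fin (suc c) → Node size
    root      : Node size
    arc-label : ∀ {α k β} → arc α k ≡ inner β → toℕ (label β) ≡ suc (toℕ (label α))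
    -- The root is the only node without incoming arcs, except that a terminal
    -- node, always present, may be unreachable.
    root-unique : ∀ β → root ≡ inner β ⇔ (∀ α k → arc α k ≢ inner β)

  width : ℕ
  width = max 0 (map (λ i → length (filter (λ α → label α ≟ i) (allFin size))) (allFin m))

  data Path : Node size → Set where
    end  : Path ⊤ₙ
    step : ∀ α k → Path (arc α k) → Path (inner α)

  uses : ∀ {x} → Path x → Fin c → Subset m
  uses end          j = ∅
  uses (step α k p) j with k ≟ suc j
  ... | yes _ = ⁅ label α ⁆ ∪ uses p j
  ... | no  _ = uses p j

  uses-≥ : ∀ {x} (p : Path x) j {i} → i ∈ uses p j → ∃ λ β → x ≡ inner β × label β ≤ i
  uses-> : ∀ {α k} (p : Path (arc α k)) j {i} → i ∈ uses p j → label α < i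

  uses-≥ end          j i∈ = contradiction i∈ ∉⊥
  uses-≥ (step α k p) j i∈ with k ≟ suc j
  ... | no _  = α , refl , ℕ.<⇒≤ (uses-> p j i∈)
  ... | yes _ with x∈p∪q⁻ ⁅ label α ⁆ (uses p j) i∈
  ...   | inj₁ i∈α = α , refl , ℕ.≤-reflexive (cong toℕ (sym (x∈⁅y⁆⇒x≡y _ i∈α)))
  ...   | inj₂ i∈p = α , refl , ℕ.<⇒≤ (uses-> p j i∈p)

  uses-> p j i∈ with uses-≥ p j i∈
  ... | β , eq , β≤i = subst (ℕ._≤ _) (arc-label eq) β≤i

  uses-disjoint : ∀ {x} (p : Path x) {i j y} → y ∈ uses p i → y ∈ uses p j → i ≡ j
  uses-disjoint end y∈i y∈j = contradiction y∈i ∉⊥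
  uses-disjoint (step α k p) {i} {j} y∈i y∈j with k ≟ suc i | k ≟ suc j
  ... | yes refl | yes refl = refl
  ... | no _     | no _     = uses-disjoint p y∈i y∈j
  ... | yes _    | no _     with x∈p∪q⁻ ⁅ label α ⁆ (uses p i) y∈i
  ...   | inj₂ y∈p = uses-disjoint p y∈p y∈j
  ...   | inj₁ y∈α = contradiction (uses-> p j y∈j)
                       (<-irrefl (sym (x∈⁅y⁆⇒x≡y _ y∈α)))
  uses-disjoint (step α k p) {i} {j} y∈i y∈j | no _ | yes _
      with x∈p∪q⁻ ⁅ label α ⁆ (uses p j) y∈j
  ...   | inj₂ y∈p = uses-disjoint p y∈i y∈p
  ...   | inj₁ y∈α = contradiction (uses-> p i y∈i)
                       (<-irrefl (sym (x∈⁅y⁆⇒x≡y _ y∈α)))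

  ⟦_⟧ : ∀ {x} → Path x → ColouredSubset c m
  ⟦ p ⟧ = record { part = uses p ; disjoint = uses-disjoint p }

Represents : ∀ {c m} → DD c m → (ColouredSubset c m → Set) → Set
Represents Z 𝓕 = ∀ D → 𝓕 D ⇔ ∃ λ (p : Path root) → ∀ j → part ⟦ p ⟧ j ≡ part D j
  where
  open DD Z
  open ColouredSubset

_∈O_ : (ℕ → ℕ) → (ℕ → ℕ) → Set
f ∈O g = ∃₂ λ C n₀ → ∀ n → n₀ ℕ.≤ n → f n ℕ.≤ C * g n

M : List (Vec ℕ 2)
M = (3 ∷ 0 ∷ []) ∷ (1 ∷ 2 ∷ []) ∷ (1 ∷ 1 ∷ []) ∷ (1 ∷ 1 ∷ []) ∷ []

{-# OPTIONS --safe #-}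
module Submission where

-- Extended profile. A subdivision keeps all conditions if both halves of an edge inherit its colour.
-- Conversely, as long as some vertex has a degree in Δ², one such vertex has nonadjacent neighbours,
-- since adjacent neighbours would cut off a component of one colour, and it can be contracted.
-- Without such vertices only the vertices of degree (3,0), (1,2), (1,1), (1,1) are left, and these
-- degrees force K₄ − e.
--
-- Decision diagram. The nodes are the Myhill–Nerode classes of the partial colourings of e₁, …, eᵢ₋₁.
-- Two completable partial colourings are equivalent if they agree on the degrees and the connected
-- components at the frontier, on the number of vertices of each special degree that are finished,
-- and on the colours used. A frontier of size w leaves 2^O(w log w) possibilities.

open import Defs
open import Data.Bool using (Bool; true; false; T; _∧_; if_then_else_)
open import Data.Bool.Properties using (T-∧; T?)
import Data.Bool.Properties as Bool
open import Data.Empty using (⊥-elim)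
open import Data.Fin as Fin using (Fin; zero; suc; toℕ; fromℕ<; _≟_; combine; quotient; remainder; funToFin; finToFun)
open import Data.Fin.Permutation using (lift₀; transpose; _⟨$⟩ʳ_; inverseˡ; inverseʳ)
open import Data.Fin.Properties using (any?; all?; injective⇒≤; suc-injective; toℕ<n; toℕ-fromℕ<; toℕ-injective; toℕ-inject₁; remQuot-combine; combine-injective; finToFun-funToFin)
open import Data.Fin.Subset using (∣_∣; _∈_; ⁅_⁆)
open import Data.Fin.Subset.Properties using (_∈?_; ∉⊥; x∈p∪q⁻; x∈p∪q⁺; x∈⁅x⁆; x∈⁅y⁆⇒x≡y; ⊆-antisym)
open import Data.List as List using (List; []; _∷_; _++_; length; lookup; filter; map; allFin)
open import Data.List.Extrema.Nat using (max≤v⁺; xs≤max)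
open import Data.List.Membership.Propositional using () renaming (_∈_ to _∈ˡ_)
open import Data.List.Membership.Propositional.Properties using (∈-filter⁺; ∈-filter⁻; ∈-allFin; ∈-lookup)
open import Data.List.Properties using (filter-accept; filter-reject)
open import Data.List.Relation.Binary.Permutation.Propositional using (_↭_; ↭-refl; ↭-sym; ↭-trans; prep; swap)
open import Data.List.Relation.Binary.Permutation.Propositional.Properties using (All-resp-↭; ↭-length; filter-↭)
open import Data.List.Relation.Unary.All as All using (All; []; _∷_)
import Data.List.Relation.Unary.All.Properties as All
import Data.List.Relation.Unary.Any as Any
open import Data.List.Relation.Unary.Any.Properties using (lookup-index)
open import Data.List.Relation.Unary.AllPairs using ([]; _∷_)
open import Data.List.Relation.Unary.Unique.Propositional using (Unique)
open import Data.List.Relation.Unary.Unique.Propositional.Properties using (filter⁺; allFin⁺)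
open import Data.Nat as ℕ using (ℕ; zero; suc; _+_; _*_; _^_; _≤_; _<_; z≤n; s≤s)
open import Data.Nat.DivMod using (_mod_; m<n⇒m%n≡m)
open import Data.Nat.Logarithm using (⌊log₂_⌋; ⌊log₂⌋-mono-≤; ⌊log₂[2^n]⌋≡n)
import Data.Nat.Properties as ℕ
open import Algebra.Properties.CommutativeSemigroup ℕ.+-commutativeSemigroup using (interchange)
open import Data.Nat.Solver using (module +-*-Solver)
open import Data.Product using (∃; ∃₂; _×_; _,_; proj₁; proj₂)
open import Data.Sum using (_⊎_; inj₁; inj₂; [_,_]′)
open import Data.Unit using (tt)
open import Data.Vec as Vec using (Vec; []; _∷_; replicate; tabulate; _[_]≔_)
open import Data.Vec.Properties using (≡-dec; tabulate-cong; tabulate∘lookup; lookup∘update; lookup∘update′; lookup-replicate)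
open import Function.Base using (_∘_; id; case_of_)
open import Function.Bundles using (_↔_; _⇔_; mk⇔; mk↔ₛ′; module Equivalence; module Inverse)
open import Function.Properties.Inverse using (↔-sym; ↔-trans)
open import Relation.Binary.Construct.Closure.ReflexiveTransitive as Star using (Star; ε; _◅_; _◅◅_)
open import Relation.Binary.Definitions using (tri<; tri≈; tri>)
open import Relation.Binary.PropositionalEquality
open import Relation.Nullary using (¬_; Dec; yes; no; contradiction)
open import Relation.Nullary.Decidable using (⌊_⌋; toWitness; fromWitness; _×-dec_; _⊎-dec_; _→-dec_; ¬?; map′; does; toSum; decidable-stable)

open Equivalence using () renaming (to to ⇒; from to ⇐)

-- Counting

-- A vertex of degree 2 cannot always be contracted: it may lie on a triangle of the first colour
-- through the vertex of degree `(3,0)`, and such a triangle is not a component. Then the neighbour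
-- of that vertex outside the triangle is contracted instead; it cannot be a leaf, because the
-- colour has at least the two leaves `c` and `c′`.
--
-- For the diagram, taking residual classes as nodes separates correctness from width. Correctness
-- holds for every acceptance test that respects pointwise equality, and no transition function on
-- states has to be defined: a state only has to determine the residual. Completability is what
-- keeps the state small. Nothing behind the frontier has to be recorded vertex by vertex, since any
-- completion certifies that the finished vertices have admissible degrees and that no component was
-- cut off from the rest of its colour. The flag for used colours serves the one remaining case, a
-- colour that is finished and must not be used again.

bit : Bool → ℕ
bit true  = 1
bit false = 0

count : ∀ {n} → (Fin n → Bool) → ℕ
count f = ∣ tabulate f ∣

count-suc : ∀ {n} (f : Fin (suc n) → Bool) → count f ≡ bit (f zero) + count (f ∘ suc)
count-suc f with f zero
... | true  = refl
... | false = refl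

T-ext : ∀ {p q} → (T p → T q) → (T q → T p) → p ≡ q
T-ext {true}  {true}  f g = refl
T-ext {true}  {false} f g = ⊥-elim (f tt)
T-ext {false} {true}  f g = ⊥-elim (g tt)
T-ext {false} {false} f g = refl

count-+ : ∀ {n} (f g h : Fin n → Bool) → (∀ x → bit (f x) ≡ bit (g x) + bit (h x)) →
          count f ≡ count g + count h
count-+ {zero}  f g h eq = refl
count-+ {suc n} f g h eq rewrite count-suc f | count-suc g | count-suc h | eq zero
  | count-+ (f ∘ suc) (g ∘ suc) (h ∘ suc) (eq ∘ suc) =
  interchange (bit (g zero)) (bit (h zero)) (count (g ∘ suc)) (count (h ∘ suc))

count-none : ∀ {n} (f : Fin n → Bool) → (∀ x → ¬ T (f x)) → count f ≡ 0
count-none {zero}  f no-f = refl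
count-none {suc n} f no-f with f zero in eq
... | true  = contradiction (subst T (sym eq) tt) (no-f zero)
... | false = count-none (f ∘ suc) (no-f ∘ suc)

record Enumeration {n} (f : Fin n → Bool) (k : ℕ) : Set where
  field
    at       : Fin k → Fin n
    at-true  : ∀ p → T (f (at p))
    at-inj   : ∀ {p q} → at p ≡ at q → p ≡ q
    index    : ∀ x → T (f x) → Fin k
    at-index : ∀ x t → at (index x t) ≡ x

enumerate : ∀ {n} (f : Fin n → Bool) → Enumeration f (count f)
enumerate {zero} f = record
  { at = λ () ; at-true = λ () ; at-inj = λ { {()} } ; index = λ () ; at-index = λ () }
enumerate {suc n} f with f zero in eq | enumerate (f ∘ suc)
... | true | rest = record
  { at       = λ { zero → zero ; (suc p) → suc (at p) }
  ; at-true  = λ { zero → subst T (sym eq) tt ; (suc p) → at-true p }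
  ; at-inj   = λ { {zero} {zero} _ → refl ; {zero} {suc q} () ; {suc p} {zero} ()
                 ; {suc p} {suc q} e → cong suc (at-inj (suc-injective e)) }
  ; index    = λ { zero _ → zero ; (suc x) t → suc (index x t) }
  ; at-index = λ { zero _ → refl ; (suc x) t → cong suc (at-index x t) }
  }
  where open Enumeration rest
... | false | rest = record
  { at       = suc ∘ at
  ; at-true  = at-true
  ; at-inj   = at-inj ∘ suc-injective
  ; index    = λ { zero t → ⊥-elim (subst T eq t) ; (suc x) t → index x t }
  ; at-index = λ { zero t → ⊥-elim (subst T eq t) ; (suc x) t → cong suc (at-index x t) }
  }
  where open Enumeration rest

count-≤ : ∀ {a b} {f : Fin a → Bool} {g : Fin b → Bool} (h : ∀ x → T (f x) → Fin b) →
          (∀ x t → T (g (h x t))) →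
          (∀ {x y} s t → h x s ≡ h y t → x ≡ y) → count f ≤ count g
count-≤ {f = f} {g} h h-true h-inj = injective⇒≤ {f = λ p → G.index (hp p) (h-true _ _)}
  λ {p} {q} eq → F.at-inj (h-inj _ _
    (trans (sym (G.at-index (hp p) (h-true _ _)))
           (trans (cong G.at eq) (G.at-index (hp q) (h-true _ _)))))
  where
  module F = Enumeration (enumerate f)
  module G = Enumeration (enumerate g)
  hp : Fin (count f) → Fin _
  hp p = h (F.at p) (F.at-true p)

-- Only the supports have to correspond, so `h` may be arbitrary elsewhere. A map like `otherEnd`,
-- meaningful only on incident edges, can therefore stay total.
count-⤖ : ∀ {a b} {f : Fin a → Bool} {g : Fin b → Bool} (h : Fin a → Fin b) →
          (∀ x → T (f x) → T (g (h x))) →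
          (∀ {x y} → T (f x) → T (f y) → h x ≡ h y → x ≡ y) →
          (∀ y → T (g y) → ∃ λ x → T (f x) × h x ≡ y) → count f ≡ count g
count-⤖ h h-true h-inj h-surj = ℕ.≤-antisym
  (count-≤ (λ x _ → h x) h-true (λ s t → h-inj s t))
  (count-≤ (λ y t → proj₁ (h-surj y t)) (λ y t → proj₁ (proj₂ (h-surj y t)))
    λ {x} {y} s t eq → trans (sym (proj₂ (proj₂ (h-surj x s))))
                        (trans (cong h eq) (proj₂ (proj₂ (h-surj y t)))))

count-cong : ∀ {n} {f g : Fin n → Bool} → (∀ x → T (f x) → T (g x)) → (∀ x → T (g x) → T (f x)) →
             count f ≡ count g
count-cong f⇒g g⇒f = count-⤖ id f⇒g (λ _ _ → id) (λ y t → y , g⇒f y t , refl)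

count-length : ∀ {n} {P : Fin n → Set} (P? : ∀ x → Dec (P x)) →
               List.length (List.filter P? (List.allFin n)) ≡ count (⌊_⌋ ∘ P?)
count-length P? = go P? id
  where
  go : ∀ {k m} {P : Fin m → Set} (P? : ∀ x → Dec (P x)) (g : Fin k → Fin m) →
       List.length (List.filter P? (List.tabulate g)) ≡ count (⌊_⌋ ∘ P? ∘ g)
  go {zero}  P? g = refl
  go {suc k} P? g with P? (g zero)
  ... | yes _ = cong suc (go P? (g ∘ suc))
  ... | no _  = go P? (g ∘ suc)

∧-¬-elim : ∀ {P : Set} {b} {P? : Dec P} → T (b ∧ ⌊ ¬? P? ⌋) → T b × ¬ P
∧-¬-elim {P? = P?} t = let a , q = ⇒ T-∧ t in a , toWitness q

∧-¬-intro : ∀ {P : Set} {b} {P? : Dec P} → T b → ¬ P → T (b ∧ ⌊ ¬? P? ⌋)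
∧-¬-intro a q = ⇐ T-∧ (a , fromWitness q)

-- A record rather than the bare equation, so that f can be inferred.
record HasSize {n} (f : Fin n → Bool) (k : ℕ) : Set where
  constructor sized
  field
    count≡ : count f ≡ k

open HasSize

module _ {n} {f : Fin n → Bool} where
  private
    module _ {k} (eq : HasSize f k) where
      open Enumeration (subst (Enumeration f) (count≡ eq) (enumerate f)) public

  index-injective : ∀ {k} (eq : HasSize f k) {x y} (s : T (f x)) (t : T (f y)) →
                    index eq x s ≡ index eq y t → x ≡ y
  index-injective eq s t e =
    trans (sym (at-index eq _ s)) (trans (cong (at eq) e) (at-index eq _ t))

  size-0 : HasSize f 0 → ∀ x → ¬ T (f x)
  size-0 eq x t = case index eq x t of λ ()

  size-1 : HasSize f 1 → ∀ {x y} → T (f x) → T (f y) → x ≡ y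
  size-1 eq s t = index-injective eq s t (Fin1 (index eq _ s) (index eq _ t))
    where
    Fin1 : ∀ (p q : Fin 1) → p ≡ q
    Fin1 zero zero = refl

  size-2 : HasSize f 2 → ∀ {x y} → T (f x) → T (f y) → x ≢ y → ∀ z → T (f z) → z ≡ x ⊎ z ≡ y
  size-2 eq s t x≢y z r = [ inj₁ ∘ index-injective eq r s , inj₂ ∘ index-injective eq r t ]′
    (Fin2 (index eq _ s) (index eq _ t) (index eq z r) (x≢y ∘ index-injective eq s t))
    where
    Fin2 : ∀ (p q r : Fin 2) → p ≢ q → r ≡ p ⊎ r ≡ q
    Fin2 = toWitness {a? = all? λ p → all? λ q → all? λ r → ¬? (p ≟ q) →-dec (r ≟ p ⊎-dec r ≟ q)} tt

  witness : ∀ {k} → HasSize f (suc k) → ∃ λ x → T (f x)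
  witness eq = at eq zero , at-true eq zero

  size-2-other : HasSize f 2 → ∀ {x} → T (f x) → ∃ λ y → x ≢ y × T (f y)
  size-2-other eq {x} s = at eq q , x≢y , at-true eq q
    where
    Fin2 : ∀ (p : Fin 2) → ∃ λ q → p ≢ q
    Fin2 zero       = suc zero , λ ()
    Fin2 (suc zero) = zero , λ ()
    q : Fin 2
    q = proj₁ (Fin2 (index eq x s))
    x≢y : x ≢ at eq q
    x≢y e = proj₂ (Fin2 (index eq x s)) (at-inj eq (trans (at-index eq x s) e))

  abstract
    size-3-other : HasSize f 3 → ∀ {x y} → T (f x) → T (f y) → x ≢ y →
                    ∃ λ z → T (f z) × z ≢ x × z ≢ y × (∀ w → T (f w) → w ≡ x ⊎ w ≡ y ⊎ w ≡ z)
    size-3-other eq {x} {y} s t x≢y with Fin3 (index eq x s) (index eq y t) (x≢y ∘ index-injective eq s t)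
      where
      Fin3 : ∀ (p q : Fin 3) → p ≢ q → ∃ λ r → r ≢ p × r ≢ q × (∀ w → w ≡ p ⊎ w ≡ q ⊎ w ≡ r)
      Fin3 = toWitness {a? = all? λ p → all? λ q → ¬? (p ≟ q) →-dec any? λ r →
        ¬? (r ≟ p) ×-dec (¬? (r ≟ q) ×-dec all? λ w → w ≟ p ⊎-dec (w ≟ q ⊎-dec w ≟ r))} tt
    ... | r , r≢p , r≢q , all = at eq r , at-true eq r , apart s r≢p , apart t r≢q ,
        λ w u → [ inj₁ ∘ index-injective eq u s ,
                [ inj₂ ∘ inj₁ ∘ index-injective eq u t ,
                  (λ e → inj₂ (inj₂ (trans (sym (at-index eq w u)) (cong (at eq) e)))) ]′ ]′ (all (index eq w u))
      where
      apart : ∀ {v} (u : T (f v)) → r ≢ index eq v u → at eq r ≢ v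
      apart u r≢ e = r≢ (at-inj eq (trans e (sym (at-index eq _ u))))

-- By additivity the difference of the two sets has size zero. This is how equal degrees turn a
-- one-sided inclusion of neighbourhoods into an equality.
count-⊆-≡ : ∀ {n} {f g : Fin n → Bool} → (∀ x → T (f x) → T (g x)) → count f ≡ count g →
            ∀ x → T (g x) → T (f x)
count-⊆-≡ {f = f} {g} f⊆g eq x gx with T? (f x)
... | yes fx = fx
... | no ¬fx = contradiction (∧-¬-intro {P? = T? (f x)} gx ¬fx) (size-0 {f = h} (sized none) x)
  where
  h : Fin _ → Bool
  h y = g y ∧ ⌊ ¬? (T? (f y)) ⌋
  split : ∀ p q → (T p → T q) → bit q ≡ bit p + bit (q ∧ ⌊ ¬? (T? p) ⌋)
  split true  true  _ = refl
  split true  false i = ⊥-elim (i tt)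
  split false true  _ = refl
  split false false _ = refl
  none : count h ≡ 0
  none = ℕ.+-cancelˡ-≡ (count f) (count h) 0
    (trans (sym (count-+ g f h λ y → split (f y) (g y) (f⊆g y))) (trans (sym eq) (sym (ℕ.+-identityʳ _))))

guard-cong : ∀ {A : Set} {b b′} (A? : Dec A) → (A → b ≡ b′) → ⌊ A? ⌋ ∧ b ≡ ⌊ A? ⌋ ∧ b′
guard-cong (yes a) e = e a
guard-cong (no _)  e = refl

count-≗ : ∀ {n} {f g : Fin n → Bool} → f ≗ g → count f ≡ count g
count-≗ e = count-cong (λ x → subst T (e x)) (λ x → subst T (sym (e x)))

-- Meant for `A` the vertices that still have edges to come: on the others `g` can be computed from
-- the prefix alone.
count-split : ∀ {n} {A : Fin n → Set} (A? : ∀ v → Dec (A v)) (f g : Fin n → Bool) →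
              (∀ v → ¬ A v → f v ≡ g v) →
              count f ≡ count (λ v → ⌊ ¬? (A? v) ⌋ ∧ g v) + count (λ v → ⌊ A? v ⌋ ∧ f v)
count-split A? f g e = count-+ f _ _ pointwise
  where
  pointwise : ∀ v → bit (f v) ≡ bit (⌊ ¬? (A? v) ⌋ ∧ g v) + bit (⌊ A? v ⌋ ∧ f v)
  pointwise v with A? v
  ... | yes _ = refl
  ... | no ¬a = trans (cong bit (e v ¬a)) (sym (ℕ.+-identityʳ _))

-- Profiles in terms of vertex counts

Degree : Set
Degree = Vec ℕ 2

_≟ᵈ_ : (d d′ : Degree) → Dec (d ≡ d′)
_≟ᵈ_ = ≡-dec ℕ._≟_

first-entry : ∀ {m n m′ n′} → _≡_ {A = Degree} (m ∷ n ∷ []) (m′ ∷ n′ ∷ []) → m ≡ m′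
first-entry refl = refl

second-entry : ∀ {m n m′ n′} → _≡_ {A = Degree} (m ∷ n ∷ []) (m′ ∷ n′ ∷ []) → n ≡ n′
second-entry refl = refl

special : Fin 3 → Degree
special zero             = 3 ∷ 0 ∷ []
special (suc zero)       = 1 ∷ 2 ∷ []
special (suc (suc zero)) = 1 ∷ 1 ∷ []

multiplicity : Fin 3 → ℕ
multiplicity zero             = 1
multiplicity (suc zero)       = 1
multiplicity (suc (suc zero)) = 2

Allowed : Degree → Set
Allowed d = (∃ λ t → d ≡ special t) ⊎ Δ 2 d

allowed? : ∀ d → Dec (Allowed d)
allowed? d = any? (λ t → d ≟ᵈ special t) ⊎-dec any? (λ i → d ≟ᵈ (replicate 2 0 [ i ]≔ 2))

special-not-Δ : ∀ t → ¬ Δ 2 (special t)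
special-not-Δ zero (zero , ())
special-not-Δ zero (suc zero , ())
special-not-Δ (suc zero) (zero , ())
special-not-Δ (suc zero) (suc zero , ())
special-not-Δ (suc (suc zero)) (zero , ())
special-not-Δ (suc (suc zero)) (suc zero , ())

occurrences : Degree → List Degree → ℕ
occurrences d L = length (filter (_≟ᵈ d) L)

occurrences-↭ : ∀ d {L L′} → L ↭ L′ → occurrences d L ≡ occurrences d L′
occurrences-↭ d p = ↭-length (filter-↭ (_≟ᵈ d) p)

extract : ∀ d L {n} → occurrences d L ≡ suc n → ∃ λ L′ → L ↭ d ∷ L′
extract d (x ∷ L) eq with x ≟ᵈ d
... | yes refl = L , ↭-refl
... | no _     = let L′ , p = extract d L eq in x ∷ L′ , ↭-trans (prep x p) (swap x d ↭-refl)

Specials : List Degree → Set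
Specials L = (∀ t → occurrences (special t) L ≡ multiplicity t) × All Allowed L

-- The special degrees are distinct and none lies in `Δ 2`, so the added elements never disturb the
-- three counts. In place of a search for a permutation this leaves conditions that are decidable
-- and that split at a cut.
specials⇔ : ∀ L → (∃ λ A → All (Δ 2) A × L ↭ M ++ A) ⇔ Specials L
specials⇔ L = mk⇔ to from
  where
  no-special : ∀ t {A} → All (Δ 2) A → occurrences (special t) A ≡ 0
  no-special t []          = refl
  no-special t {d ∷ A} (δ ∷ δs) = trans
    (cong length (filter-reject (_≟ᵈ special t) {x = d} {xs = A} λ { refl → special-not-Δ t δ }))
    (no-special t δs)

  to : (∃ λ A → All (Δ 2) A × L ↭ M ++ A) → Specials L
  to (A , δ , p) = occ , All-resp-↭ (↭-sym p) (All.++⁺ M-allowed (All.map inj₂ δ))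
    where
    M-allowed : All Allowed M
    M-allowed = inj₁ (zero , refl) ∷ inj₁ (suc zero , refl) ∷
                inj₁ (suc (suc zero) , refl) ∷ inj₁ (suc (suc zero) , refl) ∷ []
    occ : ∀ t → occurrences (special t) L ≡ multiplicity t
    occ zero             = trans (occurrences-↭ _ p) (cong suc (no-special zero δ))
    occ (suc zero)       = trans (occurrences-↭ _ p) (cong suc (no-special (suc zero) δ))
    occ (suc (suc zero)) = trans (occurrences-↭ _ p) (cong (λ n → ℕ.suc (ℕ.suc n)) (no-special (suc (suc zero)) δ))

  all-Δ : ∀ {A} → All Allowed A → (∀ t → occurrences (special t) A ≡ 0) → All (Δ 2) A
  all-Δ [] none = []
  all-Δ {d ∷ A} (inj₁ (t , refl) ∷ _) none =
    contradiction (trans (sym (cong length (filter-accept (_≟ᵈ special t) {x = d} {xs = A} refl))) (none t)) λ ()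
  all-Δ {d ∷ A} (inj₂ δ ∷ δs) none = δ ∷ all-Δ δs λ t → trans
    (sym (cong length (filter-reject (_≟ᵈ special t) {x = d} {xs = A} λ { refl → special-not-Δ t δ }))) (none t)

  from : Specials L → ∃ λ A → All (Δ 2) A × L ↭ M ++ A
  from (occ , allowed) =
    let s₀ = special zero ; s₁ = special (suc zero) ; s₂ = special (suc (suc zero))
        L₁ , p₁ = extract _ L (occ zero)
        -- The counts are stated with the extracted elements still in front; for a concrete `t`
        -- these compute away and leave the count of the remaining list.
        o₁      = λ t → trans (sym (occurrences-↭ (special t) p₁)) (occ t)
        L₂ , p₂ = extract _ L₁ (o₁ (suc zero))
        o₂      = λ t → trans (sym (occurrences-↭ (special t) (prep s₀ p₂))) (o₁ t)
        L₃ , p₃ = extract _ L₂ (o₂ (suc (suc zero)))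
        o₃      = λ t → trans (sym (occurrences-↭ (special t) (prep s₀ (prep s₁ p₃)))) (o₂ t)
        L₄ , p₄ = extract _ L₃ (ℕ.suc-injective (o₃ (suc (suc zero))))
        o₄      = λ t → trans (sym (occurrences-↭ (special t) (prep s₀ (prep s₁ (prep s₂ p₄))))) (o₃ t)
        p       = ↭-trans p₁ (prep s₀ (↭-trans p₂ (prep s₁ (↭-trans p₃ (prep s₂ p₄)))))
        none    = λ { zero → ℕ.suc-injective (o₄ zero)
                    ; (suc zero) → ℕ.suc-injective (o₄ (suc zero))
                    ; (suc (suc zero)) → ℕ.suc-injective (ℕ.suc-injective (o₄ (suc (suc zero)))) }
    in L₄ , all-Δ (All.++⁻ʳ M (All-resp-↭ p allowed)) none , p

record Profile (Fᶜ : ColouredGraph 2) : Set where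
  field
    specials  : ∀ t → count (λ v → ⌊ colouredDegree Fᶜ v ≟ᵈ special t ⌋) ≡ multiplicity t
    allowed   : ∀ v → Allowed (colouredDegree Fᶜ v)
    connected : ∀ i → ColourConnected Fᶜ i

occurrences-map : ∀ {n} d (f : Fin n → Degree) →
                  occurrences d (map f (allFin n)) ≡ count (λ v → ⌊ f v ≟ᵈ d ⌋)
occurrences-map d f = trans (go (allFin _)) (count-length (λ v → f v ≟ᵈ d))
  where
  go : ∀ L → occurrences d (map f L) ≡ length (filter (λ v → f v ≟ᵈ d) L)
  go []      = refl
  go (x ∷ L) with does (f x ≟ᵈ d)
  ... | true  = cong suc (go L)
  ... | false = go L

𝒞*⇔Profile : ∀ Fᶜ → 𝒞* M Fᶜ ⇔ Profile Fᶜ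
𝒞*⇔Profile Fᶜ = mk⇔ to from
  where
  open Equivalence (specials⇔ (DS Fᶜ)) renaming (to to forth; from to back)

  to : 𝒞* M Fᶜ → Profile Fᶜ
  to h = let s , a = forth (𝒞*.degrees h) in record
    { specials  = λ t → trans (sym (occurrences-map (special t) (colouredDegree Fᶜ))) (s t)
    ; allowed   = All.tabulate⁻ (All.map⁻ a)
    ; connected = 𝒞*.connected h
    }

  from : Profile Fᶜ → 𝒞* M Fᶜ
  from h = record
    { degrees   = back ((λ t → trans (occurrences-map (special t) (colouredDegree Fᶜ)) (specials t)) ,
                        All.map⁺ (All.tabulate⁺ allowed))
    ; connected = connected
    }
    where open Profile h

-- Isomorphisms and subdivisions

≅-sym : ∀ {F G} → F ≅ G → G ≅ F
≅-sym {F} {G} φ = record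
  { bijection     = ↔-sym bijection
  ; adj-preserved = λ u v → mk⇔
      (λ a → ⇐ (adj-preserved (from u) (from v)) (subst₂ (Adj G) (sym (inv u)) (sym (inv v)) a))
      (λ a → subst₂ (Adj G) (inv u) (inv v) (⇒ (adj-preserved (from u) (from v)) a))
  }
  where
  open _≅_ φ
  inv : ∀ u → to (from u) ≡ u
  inv = Inverse.strictlyInverseˡ bijection

≅-trans : ∀ {F G H} → F ≅ G → G ≅ H → F ≅ H
≅-trans φ ψ = record
  { bijection     = ↔-trans φ.bijection ψ.bijection
  ; adj-preserved = λ u v → mk⇔
      (⇒ (ψ.adj-preserved _ _) ∘ ⇒ (φ.adj-preserved u v))
      (⇐ (φ.adj-preserved u v) ∘ ⇐ (ψ.adj-preserved _ _))
  }
  where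
  module φ = _≅_ φ
  module ψ = _≅_ ψ

𝒮-resp-≅ : ∀ {H F F′} → 𝒮 H F → F ≅ F′ → 𝒮 H F′
𝒮-resp-≅ (base φ)              ψ = base (≅-trans φ ψ)
𝒮-resp-≅ (subdivide s u v a φ) ψ = subdivide s u v a (≅-trans φ ψ)

SameEnds-map : ∀ {m n} (f : Fin m → Fin n) {u v x y} → SameEnds u v x y → SameEnds (f u) (f v) (f x) (f y)
SameEnds-map f (inj₁ (p , q)) = inj₁ (cong f p , cong f q)
SameEnds-map f (inj₂ (p , q)) = inj₂ (cong f p , cong f q)

subdivideEdge-cong : ∀ {F G} (φ : F ≅ G) u v →
                     subdivideEdge F u v ≅ subdivideEdge G (_≅_.to φ u) (_≅_.to φ v)
subdivideEdge-cong {F} {G} φ u v = record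
  { bijection     = lift₀ bijection
  ; adj-preserved = λ
      { zero    zero    → mk⇔ id id
      ; zero    (suc y) → ends y
      ; (suc x) zero    → ends x
      ; (suc x) (suc y) → mk⇔
          (λ t → let a , q = ∧-¬-elim {P? = sameEnds? u v x y} t in
             ∧-¬-intro {P? = sameEnds? (to u) (to v) (to x) (to y)} (⇒ (adj-preserved x y) a)
               (q ∘ back))
          (λ t → let a , q = ∧-¬-elim {P? = sameEnds? (to u) (to v) (to x) (to y)} t in
             ∧-¬-intro {P? = sameEnds? u v x y} (⇐ (adj-preserved x y) a) (q ∘ SameEnds-map to))
      }
  }
  where
  open _≅_ φ
  inj : ∀ {x y} → to x ≡ to y → x ≡ y
  inj e = trans (sym (Inverse.strictlyInverseʳ bijection _))
         (trans (cong from e) (Inverse.strictlyInverseʳ bijection _))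
  back : ∀ {x y} → SameEnds (to u) (to v) (to x) (to y) → SameEnds u v x y
  back (inj₁ (p , q)) = inj₁ (inj p , inj q)
  back (inj₂ (p , q)) = inj₂ (inj p , inj q)
  ends : ∀ x → T ⌊ x ≟ u ⊎-dec x ≟ v ⌋ ⇔ T ⌊ to x ≟ to u ⊎-dec to x ≟ to v ⌋
  ends x = mk⇔
    (λ t → fromWitness ([ inj₁ ∘ cong to , inj₂ ∘ cong to ]′ (toWitness t)))
    (λ t → fromWitness ([ inj₁ ∘ inj , inj₂ ∘ inj ]′ (toWitness t)))

module _ {c} (Fᶜ : ColouredGraph c) where
  E : Fin c → Fin (ColouredGraph.order Fᶜ) → Fin (ColouredGraph.order Fᶜ) → Set
  E i u v = T (ColouredGraph.edge Fᶜ i u v)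

  adj⇔edge : ∀ u v → Adj (underlying Fᶜ) u v ⇔ ∃ λ i → E i u v
  adj⇔edge u v = mk⇔ toWitness fromWitness

infix 4 _≅ᶜ_

record _≅ᶜ_ {c} (F G : ColouredGraph c) : Set where
  field
    bijection      : Fin (ColouredGraph.order F) ↔ Fin (ColouredGraph.order G)
  open Inverse bijection public using (to; from)
  field
    edge-preserved : ∀ i u v → E F i u v ⇔ E G i (to u) (to v)

  to-from : ∀ v → to (from v) ≡ v
  to-from = Inverse.strictlyInverseˡ bijection

  to-injective : ∀ {u v} → to u ≡ to v → u ≡ v
  to-injective e = trans (sym (Inverse.strictlyInverseʳ bijection _))
                  (trans (cong from e) (Inverse.strictlyInverseʳ bijection _))

module _ {c} {F G : ColouredGraph c} (φ : F ≅ᶜ G) where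
  open _≅ᶜ_ φ

  underlying-≅ : underlying F ≅ underlying G
  underlying-≅ = record
    { bijection     = bijection
    ; adj-preserved = λ u v → mk⇔
        (λ a → let i , e = ⇒ (adj⇔edge F u v) a in ⇐ (adj⇔edge G _ _) (i , ⇒ (edge-preserved i u v) e))
        (λ a → let i , e = ⇒ (adj⇔edge G _ _) a in ⇐ (adj⇔edge F u v) (i , ⇐ (edge-preserved i u v) e))
    }

  ≅ᶜ-sym : G ≅ᶜ F
  ≅ᶜ-sym = record
    { bijection      = ↔-sym bijection
    ; edge-preserved = λ i u v → mk⇔
        (λ a → ⇐ (edge-preserved i (from u) (from v)) (subst₂ (E G i) (sym (to-from u)) (sym (to-from v)) a))
        (λ a → subst₂ (E G i) (to-from u) (to-from v) (⇒ (edge-preserved i (from u) (from v)) a))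
    }

  degree-≅ᶜ : ∀ u → colouredDegree F u ≡ colouredDegree G (to u)
  degree-≅ᶜ u = tabulate-cong λ i → count-⤖ to
    (λ v → ⇒ (edge-preserved i u v))
    (λ _ _ → to-injective)
    (λ w e → from w , ⇐ (edge-preserved i u (from w)) (subst (E G i (to u)) (sym (to-from w)) e) , to-from w)

Profile-resp-≅ᶜ : ∀ {F G} → F ≅ᶜ G → Profile F → Profile G
Profile-resp-≅ᶜ {F} {G} φ p = record
  { specials  = λ t → trans (sym (count-⤖ to
      (λ v e → fromWitness (trans (sym (degree-≅ᶜ φ v)) (toWitness e)))
      (λ _ _ → to-injective)
      (λ v e → from v , fromWitness (trans (degree-at v) (toWitness e)) , to-from v)))
      (specials t)
  ; allowed   = λ v → subst Allowed (degree-at v) (allowed (from v))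
  ; connected = λ i u v (_ , eu) (_ , ev) → subst₂ (Star (E G i)) (to-from u) (to-from v)
      (Star.gmap to (λ {x} {y} → ⇒ (edge-preserved i x y))
        (connected i (from u) (from v)
          (_ , ⇒ (_≅ᶜ_.edge-preserved (≅ᶜ-sym φ) i u _) eu)
          (_ , ⇒ (_≅ᶜ_.edge-preserved (≅ᶜ-sym φ) i v _) ev)))
  }
  where
  open _≅ᶜ_ φ
  open Profile p
  degree-at : ∀ v → colouredDegree F (from v) ≡ colouredDegree G v
  degree-at v = trans (degree-≅ᶜ φ (from v)) (cong (colouredDegree G) (to-from v))

-- The colour of the subdivided edge is inherited by its two halves.
module _ {c} (Fᶜ : ColouredGraph c) (i : Fin c) (u v : Fin (ColouredGraph.order Fᶜ)) where
  open ColouredGraph Fᶜ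

  subdivideᶜ : ColouredGraph c
  subdivideᶜ = record
    { order    = suc order
    ; edge     = edge′
    ; irrefl   = λ { j zero () ; j (suc x) t → irrefl j x (proj₁ (∧-¬-elim {P? = sameEnds? u v x x} t)) }
    ; symm     = symm′
    ; disjoint = disjoint′
    }
    where
    half : Fin c → Fin order → Bool
    half j x = ⌊ j ≟ i ×-dec (x ≟ u ⊎-dec x ≟ v) ⌋

    edge′ : Fin c → Fin (suc order) → Fin (suc order) → Bool
    edge′ j zero    zero    = false
    edge′ j zero    (suc y) = half j y
    edge′ j (suc x) zero    = half j x
    edge′ j (suc x) (suc y) = edge j x y ∧ ⌊ ¬? (sameEnds? u v x y) ⌋

    symm′ : ∀ j x y → T (edge′ j x y) → T (edge′ j y x)
    symm′ j zero    (suc y) t = t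
    symm′ j (suc x) zero    t = t
    symm′ j (suc x) (suc y) t = let e , q = ∧-¬-elim {P? = sameEnds? u v x y} t in
      ∧-¬-intro {P? = sameEnds? u v y x} (symm j x y e) (q ∘ sameEnds-sym)

    half-colour : ∀ j k x → T (half j x) → T (half k x) → j ≡ k
    half-colour j k x s t = trans (proj₁ (toWitness s)) (sym (proj₁ (toWitness t)))

    disjoint′ : ∀ j k x y → T (edge′ j x y) → T (edge′ k x y) → j ≡ k
    disjoint′ j k zero    (suc y) s t = half-colour j k y s t
    disjoint′ j k (suc x) zero    s t = half-colour j k x s t
    disjoint′ j k (suc x) (suc y) s t =
      disjoint j k x y (proj₁ (∧-¬-elim {P? = sameEnds? u v x y} s))
                       (proj₁ (∧-¬-elim {P? = sameEnds? u v x y} t))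

  underlying-subdivideᶜ : underlying subdivideᶜ ≅ subdivideEdge (underlying Fᶜ) u v
  underlying-subdivideᶜ = record
    { bijection     = mk↔ₛ′ id id (λ _ → refl) (λ _ → refl)
    ; adj-preserved = λ
        { zero    zero    → mk⇔ (λ a → proj₂ (toAdj zero zero a)) λ ()
        ; zero    (suc y) → mk⇔ (λ a → fromWitness (proj₂ (half (toAdj zero (suc y) a))))
            (λ a → fromAdj zero (suc y) (i , fromWitness (refl , toWitness a)))
        ; (suc x) zero    → mk⇔ (λ a → fromWitness (proj₂ (half (toAdj (suc x) zero a))))
            (λ a → fromAdj (suc x) zero (i , fromWitness (refl , toWitness a)))
        ; (suc x) (suc y) → mk⇔
            (λ a → let j , e = toAdj (suc x) (suc y) a ; e′ , q = ∧-¬-elim {P? = sameEnds? u v x y} e in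
               ∧-¬-intro {P? = sameEnds? u v x y} (⇐ (adj⇔edge Fᶜ x y) (j , e′)) q)
            (λ a → let e , q = ∧-¬-elim {P? = sameEnds? u v x y} a ; j , e′ = ⇒ (adj⇔edge Fᶜ x y) e in
               fromAdj (suc x) (suc y) (j , ∧-¬-intro {P? = sameEnds? u v x y} e′ q))
        }
    }
    where
    toAdj : ∀ x y → Adj (underlying subdivideᶜ) x y → ∃ λ j → E subdivideᶜ j x y
    toAdj x y = ⇒ (adj⇔edge subdivideᶜ x y)
    fromAdj : ∀ x y → (∃ λ j → E subdivideᶜ j x y) → Adj (underlying subdivideᶜ) x y
    fromAdj x y = ⇐ (adj⇔edge subdivideᶜ x y)
    half : ∀ {x} → (∃ λ j → T ⌊ j ≟ i ×-dec (x ≟ u ⊎-dec x ≟ v) ⌋) → i ≡ i × (x ≡ u ⊎ x ≡ v)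
    half (j , t) = refl , proj₂ (toWitness t)

module _ {c} (Fᶜ : ColouredGraph c) (i : Fin c) (u v : Fin (ColouredGraph.order Fᶜ))
         (uv : E Fᶜ i u v) where
  open ColouredGraph Fᶜ

  private
    S : ColouredGraph c
    S = subdivideᶜ Fᶜ i u v

  u≢v : u ≢ v
  u≢v refl = irrefl i u uv

  old-edge : ∀ j x y → E S j (suc x) (suc y) → E Fᶜ j x y × ¬ SameEnds u v x y
  old-edge j x y = ∧-¬-elim {P? = sameEnds? u v x y}

  same-edge : ∀ {x y} → SameEnds u v x y → E Fᶜ i x y
  same-edge (inj₁ (refl , refl)) = uv
  same-edge (inj₂ (refl , refl)) = symm i u v uv

  same-colour : ∀ {j x y} → SameEnds u v x y → E Fᶜ j x y → j ≡ i
  same-colour s e = disjoint _ _ _ _ e (same-edge s)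

  same-other : ∀ {x y z} → SameEnds u v x y → SameEnds u v x z → y ≡ z
  same-other (inj₁ (_ , p)) (inj₁ (_ , q)) = trans p (sym q)
  same-other (inj₂ (_ , p)) (inj₂ (_ , q)) = trans p (sym q)
  same-other (inj₁ (p , _)) (inj₂ (q , _)) = contradiction (trans (sym p) q) u≢v
  same-other (inj₂ (p , _)) (inj₁ (q , _)) = contradiction (trans (sym q) p) u≢v

  is-end : ∀ {x y} → SameEnds u v x y → x ≡ u ⊎ x ≡ v
  is-end (inj₁ (p , _)) = inj₁ p
  is-end (inj₂ (p , _)) = inj₂ p

  other-end : ∀ {x} → x ≡ u ⊎ x ≡ v → ∃ λ y → SameEnds u v x y
  other-end (inj₁ p) = v , inj₁ (p , refl)
  other-end (inj₂ p) = u , inj₂ (p , refl)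

  new-edge : ∀ j x → E S j zero (suc x) ⇔ (j ≡ i × (x ≡ u ⊎ x ≡ v))
  new-edge j x = mk⇔ toWitness fromWitness

  -- At an end of the subdivided edge the neighbour across it is exchanged for the new vertex, in
  -- the same colour; all other neighbours stay.
  degree-old : ∀ x → colouredDegree Fᶜ x ≡ colouredDegree S (suc x)
  degree-old x = tabulate-cong λ j → count-⤖ h (h-edge j) (h-inj j) (h-surj j)
    where
    h : Fin order → Fin (suc order)
    h y with sameEnds? u v x y
    ... | yes _ = zero
    ... | no _  = suc y

    h-edge : ∀ j y → E Fᶜ j x y → E S j (suc x) (h y)
    h-edge j y e with sameEnds? u v x y in eq
    ... | yes s = fromWitness (same-colour s e , is-end s)
    ... | no ¬s = ∧-¬-intro {P? = sameEnds? u v x y} e ¬s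

    h-inj : ∀ j {y z} → E Fᶜ j x y → E Fᶜ j x z → h y ≡ h z → y ≡ z
    h-inj j {y} {z} _ _ eq with sameEnds? u v x y | sameEnds? u v x z
    h-inj j _ _ eq | yes s | yes t = same-other s t
    h-inj j _ _ eq | no _  | no _  = suc-injective eq
    h-inj j _ _ () | yes _ | no _
    h-inj j _ _ () | no _  | yes _

    h-zero : ∀ y → SameEnds u v x y → h y ≡ zero
    h-zero y s with sameEnds? u v x y
    ... | yes _ = refl
    ... | no ¬s = contradiction s ¬s

    h-suc : ∀ y → ¬ SameEnds u v x y → h y ≡ suc y
    h-suc y ¬s with sameEnds? u v x y
    ... | yes s = contradiction s ¬s
    ... | no _  = refl

    h-surj : ∀ j z → E S j (suc x) z → ∃ λ y → E Fᶜ j x y × h y ≡ z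
    h-surj j zero e with ⇒ (new-edge j x) e
    ... | refl , p = let y , s = other-end p in y , same-edge s , h-zero y s
    h-surj j (suc y) e = let e′ , ¬s = old-edge j x y e in y , e′ , h-suc y ¬s

  degree-new : ∀ j → count (ColouredGraph.edge S j zero) ≡ Vec.lookup (replicate c 0 [ i ]≔ 2) j
  degree-new j = [ same , different ]′ (toSum (j ≟ i))
    where
    different : j ≢ i → count (ColouredGraph.edge S j zero) ≡ Vec.lookup (replicate c 0 [ i ]≔ 2) j
    different j≢i = trans
      (count-none (ColouredGraph.edge S j zero) λ { zero () ; (suc x) e → j≢i (proj₁ (⇒ (new-edge j x) e)) })
      (sym (trans (lookup∘update′ j≢i (replicate c 0) 2) (lookup-replicate j 0)))

    h : Fin 2 → Fin (suc order)
    h zero       = suc u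
    h (suc zero) = suc v

    same : j ≡ i → count (ColouredGraph.edge S j zero) ≡ Vec.lookup (replicate c 0 [ i ]≔ 2) j
    same refl = trans
      (sym (count-⤖ {f = λ (_ : Fin 2) → true} {g = ColouredGraph.edge S i zero} h
        (λ { zero _ → ⇐ (new-edge i u) (refl , inj₁ refl)
           ; (suc zero) _ → ⇐ (new-edge i v) (refl , inj₂ refl) })
        (λ { {zero} {zero} _ _ _ → refl ; {suc zero} {suc zero} _ _ _ → refl
           ; {zero} {suc zero} _ _ e → contradiction (suc-injective e) u≢v
           ; {suc zero} {zero} _ _ e → contradiction (sym (suc-injective e)) u≢v })
        (λ { zero () ; (suc x) e → case proj₂ (⇒ (new-edge i x) e) of λ
           { (inj₁ refl) → zero , tt , refl ; (inj₂ refl) → suc zero , tt , refl } })))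
      (sym (lookup∘update i (replicate c 0) 2))

  edge-new : ∀ j x → E S j (suc x) zero ⇔ (j ≡ i × (x ≡ u ⊎ x ≡ v))
  edge-new j x = mk⇔ toWitness fromWitness

  -- Each edge of a walk either survives or is replaced by its two halves. A walk that starts or
  -- ends at the new vertex is first moved to `u`.
  connected-old⇒new : ∀ j → ColourConnected Fᶜ j → ColourConnected S j
  connected-old⇒new j conn x y tx ty = let x′ , px , sx = anchor x tx ; y′ , py , sy = anchor y ty in
    sx ◅◅ Star.kleisliStar suc walk (conn x′ y′ px py) ◅◅ Star.reverse (λ {a} {b} → ColouredGraph.symm S j a b) sy
    where
    walk : ∀ {x y} → E Fᶜ j x y → Star (E S j) (suc x) (suc y)
    walk {x} {y} e with sameEnds? u v x y
    ... | no ¬s = ∧-¬-intro {P? = sameEnds? u v x y} e ¬s ◅ ε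
    ... | yes s = _◅_ {j = zero} (⇐ (edge-new j x) (same-colour s e , is-end s)) (
                  ⇐ (new-edge j y) (same-colour s e , is-end (sameEnds-sym s)) ◅ ε)

    anchor : ∀ x → ∃ (λ y → E S j x y) → ∃ λ x′ → ∃ (E Fᶜ j x′) × Star (E S j) x (suc x′)
    anchor zero (suc y , e) with ⇒ (new-edge j y) e
    ... | refl , _ = u , (v , uv) , ⇐ (new-edge j u) (refl , inj₁ refl) ◅ ε
    anchor (suc x) (zero , e) with ⇒ (new-edge j x) e
    ... | refl , p = let y , s = other-end p in x , (y , same-edge s) , ε
    anchor (suc x) (suc y , e) = x , (y , proj₁ (old-edge j x y e)) , ε

  -- Collapsing the new vertex onto `u` turns one half into a trivial step and the other into the
  -- old edge.
  connected-new⇒old : ∀ j → ColourConnected S j → ColourConnected Fᶜ j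
  connected-new⇒old j conn x y tx ty =
    Star.kleisliStar collapse (λ {x} {y} → walk x y) (conn (suc x) (suc y) (touched x tx) (touched y ty))
    where
    collapse : Fin (suc order) → Fin order
    collapse zero    = u
    collapse (suc x) = x

    back : ∀ {x} → x ≡ u ⊎ x ≡ v → j ≡ i → Star (E Fᶜ j) u x
    back (inj₁ refl) refl = ε
    back (inj₂ refl) refl = uv ◅ ε

    walk : ∀ x y → E S j x y → Star (E Fᶜ j) (collapse x) (collapse y)
    walk zero    (suc y) e = let p , q = ⇒ (new-edge j y) e in back q p
    walk (suc x) zero    e = let p , q = ⇒ (new-edge j x) e in
      Star.reverse (λ {a} {b} → symm j a b) (back q p)
    walk (suc x) (suc y) e = proj₁ (old-edge j x y e) ◅ ε

    touched : ∀ x → ∃ (E Fᶜ j x) → ∃ (E S j (suc x))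
    touched x (y , e) with sameEnds? u v x y
    ... | yes s = zero , ⇐ (new-edge j x) (same-colour s e , is-end s)
    ... | no ¬s = suc y , ∧-¬-intro {P? = sameEnds? u v x y} e ¬s

module _ (Fᶜ : ColouredGraph 2) (i : Fin 2) (u v : Fin (ColouredGraph.order Fᶜ))
         (uv : E Fᶜ i u v) where
  private
    S : ColouredGraph 2
    S = subdivideᶜ Fᶜ i u v

    new-Δ : colouredDegree S zero ≡ replicate 2 0 [ i ]≔ 2
    new-Δ = trans (tabulate-cong (degree-new Fᶜ i u v uv)) (tabulate∘lookup _)

    specials-same : ∀ t → count (λ x → ⌊ colouredDegree S x ≟ᵈ special t ⌋) ≡
                          count (λ x → ⌊ colouredDegree Fᶜ x ≟ᵈ special t ⌋)
    specials-same t = trans (count-suc new)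
      (trans (cong (_+ count (new ∘ suc)) (cong bit (T-ext {q = false} new-not-special λ ())))
        (count-cong {f = new ∘ suc}
          (λ x e → fromWitness (trans (degree-old Fᶜ i u v uv x) (toWitness e)))
          (λ x e → fromWitness (trans (sym (degree-old Fᶜ i u v uv x)) (toWitness e)))))
      where
      new : Fin (ColouredGraph.order S) → Bool
      new x = ⌊ colouredDegree S x ≟ᵈ special t ⌋
      new-not-special : ¬ T (new zero)
      new-not-special e = special-not-Δ t (i , trans (sym (toWitness e)) new-Δ)

  -- The new vertex has a degree in `Δ 2`, so it enters no special count. The forward direction
  -- colours subdivisions; the backward one keeps the profile under contraction.
  Profile-subdivideᶜ : Profile Fᶜ ⇔ Profile S
  Profile-subdivideᶜ = mk⇔
    (λ p → let open Profile p in record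
      { specials  = λ t → trans (specials-same t) (specials t)
      ; allowed   = λ { zero → inj₂ (i , new-Δ)
                      ; (suc x) → subst Allowed (degree-old Fᶜ i u v uv x) (allowed x) }
      ; connected = λ j → connected-old⇒new Fᶜ i u v uv j (connected j)
      })
    (λ p → let open Profile p in record
      { specials  = λ t → trans (sym (specials-same t)) (specials t)
      ; allowed   = λ x → subst Allowed (sym (degree-old Fᶜ i u v uv x)) (allowed (suc x))
      ; connected = λ j → connected-new⇒old Fᶜ i u v uv j (connected j)
      })

-- Subdivisions of K₄ − e

K₄-e : Vertex (complete 4) → Vertex (complete 4) → Graph
K₄-e = deleteEdge (complete 4)

-- The degrees of the vertices 0, 1, 2, 3 are (3,0), (1,2), (1,1), (1,1), and {2,3} is the missing edge.
Kᶜ : ColouredGraph 2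
Kᶜ = record
  { order    = 4
  ; edge     = edge
  ; irrefl   = toWitness {a? = all? λ i → all? λ u → ¬? (T? (edge i u u))} tt
  ; symm     = toWitness {a? = all? λ i → all? λ u → all? λ v → T? (edge i u v) →-dec T? (edge i v u)} tt
  ; disjoint = toWitness {a? = all? λ i → all? λ j → all? λ u → all? λ v →
                 T? (edge i u v) →-dec (T? (edge j u v) →-dec i ≟ j)} tt
  }
  where
  edge : Fin 2 → Fin 4 → Fin 4 → Bool
  edge zero       zero             (suc _)          = true
  edge zero       (suc _)          zero             = true
  edge (suc zero) (suc zero)       (suc (suc _))    = true
  edge (suc zero) (suc (suc _))    (suc zero)       = true
  edge _          _                _                = false

Profile-Kᶜ : Profile Kᶜ
Profile-Kᶜ = record
  { specials  = λ { zero → refl ; (suc zero) → refl ; (suc (suc zero)) → refl }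
  ; allowed   = toWitness {a? = all? λ v → allowed? (colouredDegree Kᶜ v)} tt
  ; connected = λ i u v tu tv → from-hub i u tu ◅◅ Star.reverse (λ {x} {y} → ColouredGraph.symm Kᶜ i x y) (from-hub i v tv)
  }
  where
  -- Each colour of `Kᶜ` is a star, and the hub is its centre.
  hub : Fin 2 → Fin 4
  hub zero       = zero
  hub (suc zero) = suc zero

  near-hub : ∀ i u v → E Kᶜ i u v → u ≡ hub i ⊎ E Kᶜ i u (hub i)
  near-hub = toWitness {a? = all? λ i → all? λ u → all? λ v →
    T? (ColouredGraph.edge Kᶜ i u v) →-dec (u ≟ hub i ⊎-dec T? (ColouredGraph.edge Kᶜ i u (hub i)))} tt

  from-hub : ∀ i u → ∃ (E Kᶜ i u) → Star (E Kᶜ i) u (hub i)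
  from-hub i u (v , e) with near-hub i u v e
  ... | inj₁ refl = ε
  ... | inj₂ e′   = e′ ◅ ε

-- The deleted edge is arbitrary, so one formula for the permutation serves all choices, and
-- adjacency is checked by evaluation over all quadruples of vertices.
Kᶜ≅K₄-e : ∀ p q → Adj (complete 4) p q → underlying Kᶜ ≅ K₄-e p q
Kᶜ≅K₄-e p q pq = record { bijection = π ; adj-preserved = λ u v → mk⇔ (proj₁ (table p q pq u v)) (proj₂ (table p q pq u v)) }
  where
  -- Sends the ends 2, 3 of the missing edge to p, q.
  perm : Fin 4 → Fin 4 → Fin 4 ↔ Fin 4
  perm p q = ↔-trans (transpose (suc (suc (suc zero))) (transpose p (suc (suc zero)) ⟨$⟩ʳ q))
                     (transpose (suc (suc zero)) p)

  π : Fin 4 ↔ Fin 4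
  π = perm p q

  table : ∀ p q → Adj (complete 4) p q → ∀ u v →
          (Adj (underlying Kᶜ) u v → Adj (K₄-e p q) (perm p q ⟨$⟩ʳ u) (perm p q ⟨$⟩ʳ v)) ×
          (Adj (K₄-e p q) (perm p q ⟨$⟩ʳ u) (perm p q ⟨$⟩ʳ v) → Adj (underlying Kᶜ) u v)
  table = toWitness {a? = all? λ p → all? λ q → T? _ →-dec all? λ u → all? λ v →
    (T? _ →-dec T? _) ×-dec (T? _ →-dec T? _)} tt

coloured : ∀ {H} (Hᶜ : ColouredGraph 2) → underlying Hᶜ ≅ H → Profile Hᶜ →
           ∀ {F} → 𝒮 H F → ∃ λ Fᶜ → underlying Fᶜ ≅ F × Profile Fᶜ
coloured Hᶜ φ p (base ψ) = Hᶜ , ≅-trans φ ψ , p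
coloured Hᶜ φ p (subdivide {F} s u v uv χ) with coloured Hᶜ φ p s
... | Fᶜ , ψ , q = subdivideᶜ Fᶜ i u′ v′ ,
  ≅-trans (underlying-subdivideᶜ Fᶜ i u′ v′)
    (≅-trans (subst₂ (λ x y → subdivideEdge (underlying Fᶜ) u′ v′ ≅ subdivideEdge F x y)
                (inverseʳ ψ.bijection) (inverseʳ ψ.bijection) (subdivideEdge-cong ψ u′ v′)) χ) ,
  ⇒ (Profile-subdivideᶜ Fᶜ i u′ v′ (proj₂ edge)) q
  where
  module ψ = _≅_ ψ
  u′ v′ : Vertex (underlying Fᶜ)
  u′ = ψ.from u
  v′ = ψ.from v
  edge : ∃ λ i → E Fᶜ i u′ v′
  edge = ⇒ (adj⇔edge Fᶜ u′ v′) (⇒ (_≅_.adj-preserved (≅-sym ψ) u v) uv)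
  i : Fin 2
  i = proj₁ edge

-- Contracting a vertex of degree 2

record Contractible {c} (Fᶜ : ColouredGraph c) : Set where
  field
    {x y z}    : Fin (ColouredGraph.order Fᶜ)
    i          : Fin c
    y≢z        : y ≢ z
    xy         : E Fᶜ i x y
    xz         : E Fᶜ i x z
    only       : ∀ j t → E Fᶜ j x t → j ≡ i × (t ≡ y ⊎ t ≡ z)
    -- This ranges over all colours, since an existing edge of any colour would be parallel to the
    -- edge created by the contraction.
    nonadjacent : ∀ j → ¬ E Fᶜ j y z

-- The transposition of `zero` and `x` moves the contracted vertex to the place where `subdivideᶜ`
-- puts its new vertex; the remaining vertices are the successors.
contract : ∀ {c n} (Fᶜ : ColouredGraph c) → ColouredGraph.order Fᶜ ≡ suc n → Contractible Fᶜ →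
           ∃ λ Gᶜ → ColouredGraph.order Gᶜ ≡ n ×
           ∃ λ i → ∃₂ λ u v → E Gᶜ i u v × subdivideᶜ Gᶜ i u v ≅ᶜ Fᶜ
contract {c} {n} Fᶜ@record { order = suc n } refl κ = Gᶜ , refl , i , y′ , z′ ,
  ⇐ (edge⇔ i y′ z′) (inj₂ (refl , inj₁ (refl , refl))) ,
  record { bijection = τ ; edge-preserved = preserved }
  where
  open ColouredGraph Fᶜ
  open Contractible κ

  τ : Fin (suc n) ↔ Fin (suc n)
  τ = transpose zero x

  open Inverse τ using () renaming (to to τ→; from to τ←)

  ρ : Fin n → Fin (suc n)
  ρ u = τ→ (suc u)

  τ-injective : ∀ {u v} → τ→ u ≡ τ→ v → u ≡ v
  τ-injective e = trans (sym (inverseˡ τ)) (trans (cong τ← e) (inverseˡ τ))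

  ρ⁻¹ : ∀ u → u ≢ x → ∃ λ u′ → ρ u′ ≡ u
  ρ⁻¹ u u≢x with τ← u in eq
  ... | zero   = contradiction (trans (sym (inverseʳ τ)) (cong τ→ eq)) u≢x
  ... | suc u′ = u′ , trans (cong τ→ (sym eq)) (inverseʳ τ)

  edge-≢ : ∀ {j u v} → E Fᶜ j u v → v ≢ u
  edge-≢ e refl = irrefl _ _ e

  y′ z′ : Fin n
  y′ = proj₁ (ρ⁻¹ y (edge-≢ xy))
  z′ = proj₁ (ρ⁻¹ z (edge-≢ xz))

  ρy : ρ y′ ≡ y
  ρy = proj₂ (ρ⁻¹ y (edge-≢ xy))
  ρz : ρ z′ ≡ z
  ρz = proj₂ (ρ⁻¹ z (edge-≢ xz))

  ρ-injective : ∀ {u v} → ρ u ≡ ρ v → u ≡ v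
  ρ-injective = suc-injective ∘ τ-injective

  y′≢z′ : y′ ≢ z′
  y′≢z′ e = y≢z (trans (sym ρy) (trans (cong ρ e) ρz))

  edge? : ∀ j u v → Dec (E Fᶜ j (ρ u) (ρ v) ⊎ (j ≡ i × SameEnds y′ z′ u v))
  edge? j u v = T? (edge j (ρ u) (ρ v)) ⊎-dec (j ≟ i ×-dec sameEnds? y′ z′ u v)

  edge⇔ : ∀ j u v → T ⌊ edge? j u v ⌋ ⇔ (E Fᶜ j (ρ u) (ρ v) ⊎ (j ≡ i × SameEnds y′ z′ u v))
  edge⇔ j u v = mk⇔ toWitness fromWitness

  -- An old edge is never the added one. Hence the colours of `Gᶜ` stay disjoint, and subdividing
  -- deletes no edge of `Fᶜ`.
  absent : ∀ j u v → E Fᶜ j (ρ u) (ρ v) → ¬ SameEnds y′ z′ u v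
  absent j u v e (inj₁ (refl , refl)) = nonadjacent j (subst₂ (E Fᶜ j) ρy ρz e)
  absent j u v e (inj₂ (refl , refl)) = nonadjacent j (symm j z y (subst₂ (E Fᶜ j) ρz ρy e))

  Gᶜ : ColouredGraph c
  Gᶜ = record
    { order    = n
    ; edge     = λ j u v → ⌊ edge? j u v ⌋
    ; irrefl   = λ j u t → case ⇒ (edge⇔ j u u) t of λ
        { (inj₁ e) → irrefl j (ρ u) e
        ; (inj₂ (_ , inj₁ (p , q))) → y′≢z′ (trans (sym p) q)
        ; (inj₂ (_ , inj₂ (p , q))) → y′≢z′ (trans (sym q) p) }
    ; symm     = λ j u v t → ⇐ (edge⇔ j v u) (case ⇒ (edge⇔ j u v) t of λ
        { (inj₁ e) → inj₁ (symm j (ρ u) (ρ v) e)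
        ; (inj₂ (p , inj₁ (q , r))) → inj₂ (p , inj₂ (r , q))
        ; (inj₂ (p , inj₂ (q , r))) → inj₂ (p , inj₁ (r , q)) })
    ; disjoint = λ j k u v s t → case (⇒ (edge⇔ j u v) s , ⇒ (edge⇔ k u v) t) of λ
        { (inj₁ d , inj₁ e) → disjoint j k (ρ u) (ρ v) d e
        ; (inj₁ d , inj₂ (_ , q)) → contradiction q (absent j u v d)
        ; (inj₂ (_ , q) , inj₁ e) → contradiction q (absent k u v e)
        ; (inj₂ (p , _) , inj₂ (q , _)) → trans p (sym q) }
    }

  end⇔ : ∀ j u → (j ≡ i × (u ≡ y′ ⊎ u ≡ z′)) ⇔ E Fᶜ j x (ρ u)
  end⇔ j u = mk⇔
    (λ { (refl , inj₁ refl) → subst (E Fᶜ i x) (sym ρy) xy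
       ; (refl , inj₂ refl) → subst (E Fᶜ i x) (sym ρz) xz })
    (λ e → let p , q = only j (ρ u) e in p , [ (λ r → inj₁ (ρ-injective (trans r (sym ρy)))) ,
                                               (λ r → inj₂ (ρ-injective (trans r (sym ρz)))) ]′ q)

  preserved : ∀ j u v → E (subdivideᶜ Gᶜ i y′ z′) j u v ⇔ E Fᶜ j (τ→ u) (τ→ v)
  preserved j zero    zero    = mk⇔ (λ ()) (irrefl j x)
  preserved j zero    (suc v) = mk⇔ (⇒ (end⇔ j v) ∘ toWitness) (fromWitness ∘ ⇐ (end⇔ j v))
  preserved j (suc u) zero    = mk⇔ (symm j x (ρ u) ∘ ⇒ (end⇔ j u) ∘ toWitness)
                                    (fromWitness ∘ ⇐ (end⇔ j u) ∘ symm j (ρ u) x)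
  preserved j (suc u) (suc v) = mk⇔
    (λ t → let e , ¬s = ∧-¬-elim {P? = sameEnds? y′ z′ u v} t in
       case ⇒ (edge⇔ j u v) e of λ { (inj₁ e) → e ; (inj₂ (_ , s)) → contradiction s ¬s })
    (λ e → ∧-¬-intro {P? = sameEnds? y′ z′ u v} (⇐ (edge⇔ j u v) (inj₁ e)) (absent j u v e))

-- The contradictions from connectivity all come from here: `S` is a set of at most four vertices,
-- closed under the colour, that misses a vertex known to have an edge of that colour.
separated : ∀ {c} (Fᶜ : ColouredGraph c) i → ColourConnected Fᶜ i → (S : Fin (ColouredGraph.order Fᶜ) → Set) →
            (∀ u v → S u → E Fᶜ i u v → S v) → ∀ {u v} → S u → ∃ (E Fᶜ i u) → ∃ (E Fᶜ i v) → S v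
separated Fᶜ i conn S closed Su tu tv = go Su (conn _ _ tu tv)
  where
  go : ∀ {u v} → S u → Star (E Fᶜ i) u v → S v
  go Su ε       = Su
  go Su (e ◅ p) = go (closed _ _ Su e) p

-- The allowed degrees form an indexed family, so that case analysis fixes both entries at once.
data Kind : ℕ → ℕ → Set where
  k30 : Kind 3 0
  k12 : Kind 1 2
  k11 : Kind 1 1
  k20 : Kind 2 0
  k02 : Kind 0 2

kind-of : ∀ {m n} → Allowed (m ∷ n ∷ []) → Kind m n
kind-of (inj₁ (zero , refl))           = k30
kind-of (inj₁ (suc zero , refl))       = k12
kind-of (inj₁ (suc (suc zero) , refl)) = k11
kind-of (inj₂ (zero , refl))           = k20
kind-of (inj₂ (suc zero , refl))       = k02

mixed-1 : ∀ {m n} → Kind m n → m ≢ 0 → n ≢ 0 → m ≡ 1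
mixed-1 k30 _ q = contradiction refl q
mixed-1 k12 _ _ = refl
mixed-1 k11 _ _ = refl
mixed-1 k20 _ q = contradiction refl q
mixed-1 k02 p _ = contradiction refl p

second-2 : ∀ {m n} → Kind m n → n ≢ 0 → n ≢ 1 → n ≡ 2
second-2 k30 p _ = contradiction refl p
second-2 k12 _ _ = refl
second-2 k11 _ q = contradiction refl q
second-2 k20 p _ = contradiction refl p
second-2 k02 _ _ = refl

first-cases : ∀ {m n} → Kind m n → m ≢ 0 → m ≡ 1 ⊎ (m ≡ 2 × n ≡ 0) ⊎ (m ≡ 3 × n ≡ 0)
first-cases k30 _ = inj₂ (inj₂ (refl , refl))
first-cases k12 _ = inj₁ refl
first-cases k11 _ = inj₁ refl
first-cases k20 _ = inj₂ (inj₁ (refl , refl))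
first-cases k02 p = contradiction refl p

-- The structure of a graph with the profile

module _ (Fᶜ : ColouredGraph 2) (prof : Profile Fᶜ) where
  open ColouredGraph Fᶜ
  open Profile prof

  private
    c₀ c₁ : Fin 2
    c₀ = zero
    c₁ = suc zero

    V : Set
    V = Fin order

    d : Fin 2 → V → ℕ
    d i v = count (edge i v)

  kind : ∀ v → Kind (d c₀ v) (d c₁ v)
  kind v = kind-of (allowed v)

  Deg : Fin 2 → V → ℕ → Set
  Deg i v = HasSize (edge i v)

  nonzero : ∀ {i u v} → E Fᶜ i u v → ¬ Deg i u 0
  nonzero e eq = size-0 eq _ e

  two-neighbours : ∀ {i u v w} → E Fᶜ i u v → E Fᶜ i u w → v ≢ w → ¬ Deg i u 1
  two-neighbours e e′ v≢w eq = v≢w (size-1 eq e e′)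

  -- The mixed degrees `(1,2)` and `(1,1)` agree in their first entry.
  both-colours : ∀ {u v w} → E Fᶜ c₀ u v → E Fᶜ c₁ u w → Deg c₀ u 1
  both-colours {u} e e′ = sized (mixed-1 (kind u) (nonzero e ∘ sized) (nonzero e′ ∘ sized))

  two-second : ∀ {u v w} → E Fᶜ c₁ u v → E Fᶜ c₁ u w → v ≢ w → Deg c₁ u 2
  two-second {u} e e′ v≢w = sized (second-2 (kind u) (nonzero e ∘ sized) (two-neighbours e e′ v≢w ∘ sized))

  first-colour : ∀ {u v} → E Fᶜ c₀ u v → Deg c₀ u 1 ⊎ (Deg c₀ u 2 × Deg c₁ u 0) ⊎ (Deg c₀ u 3 × Deg c₁ u 0)
  first-colour {u} e with first-cases (kind u) (nonzero e ∘ sized)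
  ... | inj₁ p              = inj₁ (sized p)
  ... | inj₂ (inj₁ (p , q)) = inj₂ (inj₁ (sized p , sized q))
  ... | inj₂ (inj₂ (p , q)) = inj₂ (inj₂ (sized p , sized q))

  loopless : ∀ {i u v} → E Fᶜ i u v → u ≢ v
  loopless e refl = irrefl _ _ e

  flip : ∀ {i u v} → E Fᶜ i u v → E Fᶜ i v u
  flip = symm _ _ _

  unequal : ∀ {i j k u v} → Deg i u j → Deg i v k → j ≢ k → u ≢ v
  unequal (sized p) (sized q) j≢k refl = j≢k (trans (sym p) q)

  private
    a-exists : ∃ λ v → T ⌊ colouredDegree Fᶜ v ≟ᵈ special zero ⌋
    a-exists = witness (sized (specials zero))

    c-exists : ∃ λ v → T ⌊ colouredDegree Fᶜ v ≟ᵈ special (suc (suc zero)) ⌋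
    c-exists = witness (sized (specials (suc (suc zero))))

    c-other : ∃ λ v → proj₁ c-exists ≢ v × T ⌊ colouredDegree Fᶜ v ≟ᵈ special (suc (suc zero)) ⌋
    c-other = size-2-other (sized (specials (suc (suc zero)))) (proj₂ c-exists)

  a c c′ : V
  a  = proj₁ a-exists
  c  = proj₁ c-exists
  c′ = proj₁ c-other

  a-degree : colouredDegree Fᶜ a ≡ special zero
  a-degree = toWitness (proj₂ a-exists)
  c-degree : colouredDegree Fᶜ c ≡ special (suc (suc zero))
  c-degree = toWitness (proj₂ c-exists)
  c′-degree : colouredDegree Fᶜ c′ ≡ special (suc (suc zero))
  c′-degree = toWitness (proj₂ (proj₂ c-other))
  c≢c′ : c ≢ c′
  c≢c′ = proj₁ (proj₂ c-other)

  a-unique : ∀ {v} → Deg c₀ v 3 → v ≡ a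
  a-unique {v} eq = size-1 (sized (specials zero))
    (fromWitness (cong₂ (λ m n → m ∷ n ∷ []) (count≡ eq) (second (kind v) (count≡ eq)))) (proj₂ a-exists)
    where
    second : ∀ {m n} → Kind m n → m ≡ 3 → n ≡ 0
    second k30 _ = refl

  a₀ : Deg c₀ a 3
  a₀ = sized (first-entry a-degree)
  c₀-degree : Deg c₀ c 1
  c₀-degree = sized (first-entry c-degree)
  c₁-degree : Deg c₁ c 1
  c₁-degree = sized (second-entry c-degree)
  c′₀-degree : Deg c₀ c′ 1
  c′₀-degree = sized (first-entry c′-degree)

  absorb : ∀ i (S : V → Set) → (∀ u v → S u → E Fᶜ i u v → S v) → ∀ {u w} → S u → E Fᶜ i u w →
           ∀ {v k} → Deg i v (suc k) → S v
  absorb i S closed Su e eq = separated Fᶜ i (connected i) S closed Su (_ , e) (witness eq)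

  -- Two adjacent leaves would form a whole component of the first colour, but `a` has degree 3 in
  -- that colour and is neither of them.
  no-isolated-edge : ∀ {y z} → Deg c₀ y 1 → Deg c₀ z 1 → ¬ E Fᶜ c₀ y z
  no-isolated-edge {y} {z} dy dz yz =
    [ unequal a₀ dy (λ ()) , unequal a₀ dz (λ ()) ]′
      (absorb c₀ (λ v → v ≡ y ⊎ v ≡ z) closed (inj₁ refl) yz a₀)
    where
    closed : ∀ u v → u ≡ y ⊎ u ≡ z → E Fᶜ c₀ u v → v ≡ y ⊎ v ≡ z
    closed u v (inj₁ refl) e = inj₂ (size-1 dy e yz)
    closed u v (inj₂ refl) e = inj₁ (size-1 dz e (flip yz))

  no-isolated-path : ∀ {x y z} → Deg c₀ x 2 → Deg c₀ y 1 → Deg c₀ z 1 → y ≢ z → E Fᶜ c₀ x y → ¬ E Fᶜ c₀ x z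
  no-isolated-path {x} {y} {z} dx dy dz y≢z xy xz =
    [ unequal a₀ dx (λ ()) , [ unequal a₀ dy (λ ()) , unequal a₀ dz (λ ()) ]′ ]′
      (absorb c₀ (λ v → v ≡ x ⊎ v ≡ y ⊎ v ≡ z) closed (inj₁ refl) xy a₀)
    where
    closed : ∀ u v → u ≡ x ⊎ u ≡ y ⊎ u ≡ z → E Fᶜ c₀ u v → v ≡ x ⊎ v ≡ y ⊎ v ≡ z
    closed u v (inj₁ refl)        e = inj₂ (size-2 dx xy xz y≢z v e)
    closed u v (inj₂ (inj₁ refl)) e = inj₁ (size-1 dy e (flip xy))
    closed u v (inj₂ (inj₂ refl)) e = inj₁ (size-1 dz e (flip xz))

  -- The vertex outside the triangle is `c` rather than `a`, because `c` has edges of both colours.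
  no-isolated-triangle : ∀ i {x y z} → Deg i c 1 → Deg i x 2 → Deg i y 2 → Deg i z 2 → y ≢ z →
                         E Fᶜ i x y → E Fᶜ i x z → ¬ E Fᶜ i y z
  no-isolated-triangle i {x} {y} {z} dc dx dy dz y≢z xy xz yz =
    [ unequal dc dx (λ ()) , [ unequal dc dy (λ ()) , unequal dc dz (λ ()) ]′ ]′
      (absorb i (λ v → v ≡ x ⊎ v ≡ y ⊎ v ≡ z) closed (inj₁ refl) xy dc)
    where
    closed : ∀ u v → u ≡ x ⊎ u ≡ y ⊎ u ≡ z → E Fᶜ i u v → v ≡ x ⊎ v ≡ y ⊎ v ≡ z
    closed u v (inj₁ refl)        e = inj₂ (size-2 dx xy xz y≢z v e)
    closed u v (inj₂ (inj₁ refl)) e = [ inj₁ , inj₂ ∘ inj₂ ]′ (size-2 dy (flip xy) yz (loopless xz) v e)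
    closed u v (inj₂ (inj₂ refl)) e = [ inj₁ , inj₂ ∘ inj₁ ]′ (size-2 dz (flip xz) (flip yz) (loopless xy) v e)

  -- At a triangle through the vertex p of degree (3,0), contract the third neighbour of p instead.
  contract-at-triangle : ∀ {p x q} → Deg c₀ p 3 → Deg c₀ x 2 → Deg c₀ q 2 →
                         E Fᶜ c₀ x p → E Fᶜ c₀ x q → E Fᶜ c₀ p q → Contractible Fᶜ
  contract-at-triangle {p} {x} {q} dp dx dq xp xq pq
    with size-3-other dp (flip xp) pq (loopless xq)
  ... | t , pt , t≢x , t≢q , all = [ leaf , [ Δ-vertex , special-vertex ]′ ]′ (first-colour (flip pt))
    where
    -- If `t` were a leaf, `x`, `p`, `q` and `t` would form the whole first colour with `t` as its
    -- only vertex of degree 1, whereas `c` and `c′` both have degree 1.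
    leaf : Deg c₀ t 1 → Contractible Fᶜ
    leaf dt = contradiction (trans (is-t c₀-degree) (sym (is-t c′₀-degree))) c≢c′
      where
      S : V → Set
      S v = v ≡ x ⊎ v ≡ p ⊎ v ≡ q ⊎ v ≡ t
      closed : ∀ u v → S u → E Fᶜ c₀ u v → S v
      closed u v (inj₁ refl) e = [ inj₂ ∘ inj₁ , inj₂ ∘ inj₂ ∘ inj₁ ]′ (size-2 dx xp xq (loopless pq) v e)
      closed u v (inj₂ (inj₁ refl)) e = [ inj₁ , inj₂ ∘ inj₂ ]′ (all v e)
      closed u v (inj₂ (inj₂ (inj₁ refl))) e =
        [ inj₁ , inj₂ ∘ inj₁ ]′ (size-2 dq (flip xq) (flip pq) (loopless xp) v e)
      closed u v (inj₂ (inj₂ (inj₂ refl))) e = inj₂ (inj₁ (size-1 dt e (flip pt)))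
      is-t : ∀ {v} → Deg c₀ v 1 → v ≡ t
      is-t dv with absorb c₀ S closed (inj₁ refl) xp dv
      ... | inj₁ r               = contradiction r (unequal dv dx λ ())
      ... | inj₂ (inj₁ r)        = contradiction r (unequal dv dp λ ())
      ... | inj₂ (inj₂ (inj₁ r)) = contradiction r (unequal dv dq λ ())
      ... | inj₂ (inj₂ (inj₂ r)) = r

    special-vertex : Deg c₀ t 3 × Deg c₁ t 0 → Contractible Fᶜ
    special-vertex (dt , _) = contradiction (trans (a-unique dp) (sym (a-unique dt))) (loopless pt)

    Δ-vertex : Deg c₀ t 2 × Deg c₁ t 0 → Contractible Fᶜ
    Δ-vertex (dt , dt₁) with size-2-other dt (flip pt)
    ... | s , p≢s , ts = record
      { i = c₀ ; y≢z = p≢s ; xy = flip pt ; xz = ts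
      ; only = λ { zero w e → refl , size-2 dt (flip pt) ts p≢s w e
                 ; (suc zero) w e → contradiction dt₁ (nonzero e) }
      ; nonadjacent = λ { zero e → nonadjacent₀ e
                        ; (suc zero) e → nonzero e (sized (second-entry (subst (λ v → colouredDegree Fᶜ v ≡ special zero)
                                                     (sym (a-unique dp)) a-degree))) }
      }
      where
      -- The neighbours of `p` are `x`, `q` and `t`. Both neighbours of `x` and of `q` lie on the
      -- triangle, so neither is adjacent to `t`, and `s` cannot be `t` itself.
      nonadjacent₀ : ¬ E Fᶜ c₀ p s
      nonadjacent₀ e with all s e
      ... | inj₁ refl        = [ loopless pt ∘ sym , t≢q ]′ (size-2 dx xp xq (loopless pq) t (flip ts))
      ... | inj₂ (inj₁ refl) = [ t≢x , loopless pt ∘ sym ]′ (size-2 dq (flip xq) (flip pq) (loopless xp) t (flip ts))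
      ... | inj₂ (inj₂ refl) = irrefl c₀ t ts

  -- If the neighbours of `x` are adjacent, the degrees they are then forced to have make an edge, a
  -- path or a triangle a full component. The only exception is a triangle of the first colour
  -- through the vertex of degree `(3,0)`.
  Δ-contractible : (∃ λ x → Δ 2 (colouredDegree Fᶜ x)) → Contractible Fᶜ
  Δ-contractible (x , zero , eq) = go
    where
    dx : Deg c₀ x 2
    dx = sized (first-entry eq)
    y z : V
    y = proj₁ (witness dx)
    xy : E Fᶜ c₀ x y
    xy = proj₂ (witness dx)
    z = proj₁ (size-2-other dx xy)
    y≢z : y ≢ z
    y≢z = proj₁ (proj₂ (size-2-other dx xy))
    xz : E Fᶜ c₀ x z
    xz = proj₂ (proj₂ (size-2-other dx xy))

    triangle : E Fᶜ c₀ y z → Contractible Fᶜ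
    triangle yz with first-colour (flip xy) | first-colour (flip xz)
    ... | inj₁ dy | _ = contradiction dy (two-neighbours (flip xy) yz (loopless xz))
    ... | _ | inj₁ dz = contradiction dz (two-neighbours (flip xz) (flip yz) (loopless xy))
    ... | inj₂ (inj₂ (dy , _)) | inj₂ (inj₂ (dz , _)) =
          contradiction (trans (a-unique dy) (sym (a-unique dz))) y≢z
    ... | inj₂ (inj₁ (dy , _)) | inj₂ (inj₁ (dz , _)) =
          contradiction yz (no-isolated-triangle c₀ c₀-degree dx dy dz y≢z xy xz)
    ... | inj₂ (inj₂ (dy , _)) | inj₂ (inj₁ (dz , _)) = contract-at-triangle dy dx dz xy xz yz
    ... | inj₂ (inj₁ (dy , _)) | inj₂ (inj₂ (dz , _)) = contract-at-triangle dz dx dy xz xy (flip yz)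

    go : Contractible Fᶜ
    go with any? (λ j → T? (edge j y z))
    ... | yes (zero , yz)     = triangle yz
    -- An edge of the second colour makes `y` and `z` mixed, hence leaves of the first colour, and
    -- the path through `x` is isolated.
    ... | yes (suc zero , yz) = contradiction xz (no-isolated-path dx
            (both-colours (flip xy) yz) (both-colours (flip xz) (flip yz)) y≢z xy)
    ... | no ¬yz = record
      { i = c₀ ; y≢z = y≢z ; xy = xy ; xz = xz
      ; only = λ { zero w e → refl , size-2 dx xy xz y≢z w e
                 ; (suc zero) w e → contradiction (sized (second-entry eq)) (nonzero e) }
      ; nonadjacent = λ j e → ¬yz (j , e)
      }
  Δ-contractible (x , suc zero , eq) = go
    where
    dx : Deg c₁ x 2
    dx = sized (second-entry eq)
    y z : V
    y = proj₁ (witness dx)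
    xy : E Fᶜ c₁ x y
    xy = proj₂ (witness dx)
    z = proj₁ (size-2-other dx xy)
    y≢z : y ≢ z
    y≢z = proj₁ (proj₂ (size-2-other dx xy))
    xz : E Fᶜ c₁ x z
    xz = proj₂ (proj₂ (size-2-other dx xy))

    go : Contractible Fᶜ
    go with any? (λ j → T? (edge j y z))
    -- Here `y` and `z` carry both colours, so their edge of the first colour is isolated.
    ... | yes (zero , yz)     = contradiction yz (no-isolated-edge
            (both-colours yz (flip xy)) (both-colours (flip yz) (flip xz)))
    ... | yes (suc zero , yz) = contradiction yz (no-isolated-triangle c₁ c₁-degree dx
            (two-second (flip xy) yz (loopless xz))
            (two-second (flip xz) (flip yz) (loopless xy)) y≢z xy xz)
    ... | no ¬yz = record
      { i = c₁ ; y≢z = y≢z ; xy = xy ; xz = xz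
      ; only = λ { zero w e → contradiction (sized (first-entry eq)) (nonzero e)
                 ; (suc zero) w e → refl , size-2 dx xy xz y≢z w e }
      ; nonadjacent = λ j e → ¬yz (j , e)
      }

  -- Without degrees in `Δ 2` the vertices are exactly `a`, `b`, `c` and `c′`, and their degrees
  -- leave just one way to place the edges.
  Kᶜ≅ : ¬ (∃ λ x → Δ 2 (colouredDegree Fᶜ x)) → Kᶜ ≅ᶜ Fᶜ
  Kᶜ≅ no-Δ = record
    { bijection      = mk↔ₛ′ h g h∘g (λ p → h-injective _ _ (h∘g (h p)))
    ; edge-preserved = λ j p q → mk⇔ (K⇒F j p q) (F⇒K j p q)
    }
    where
    b-exists : ∃ λ v → T ⌊ colouredDegree Fᶜ v ≟ᵈ special (suc zero) ⌋
    b-exists = witness (sized (specials (suc zero)))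
    b : V
    b = proj₁ b-exists

    h : Fin 4 → V
    h zero                   = a
    h (suc zero)             = b
    h (suc (suc zero))       = c
    h (suc (suc (suc zero))) = c′

    h-degree : ∀ p → colouredDegree Fᶜ (h p) ≡ colouredDegree Kᶜ p
    h-degree zero                   = a-degree
    h-degree (suc zero)             = toWitness (proj₂ b-exists)
    h-degree (suc (suc zero))       = c-degree
    h-degree (suc (suc (suc zero))) = c′-degree

    h-injective : ∀ p q → h p ≡ h q → p ≡ q
    h-injective p q e with distinguish p q (trans (sym (h-degree p)) (trans (cong (colouredDegree Fᶜ) e) (h-degree q)))
      where
      distinguish : ∀ p q → colouredDegree Kᶜ p ≡ colouredDegree Kᶜ q →
                    p ≡ q ⊎ (p ≡ suc (suc zero) × q ≡ suc (suc (suc zero))) ⊎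
                             (q ≡ suc (suc zero) × p ≡ suc (suc (suc zero)))
      distinguish = toWitness {a? = all? λ p → all? λ q → (colouredDegree Kᶜ p ≟ᵈ colouredDegree Kᶜ q) →-dec
        (p ≟ q ⊎-dec ((p ≟ suc (suc zero) ×-dec q ≟ suc (suc (suc zero))) ⊎-dec
                       (q ≟ suc (suc zero) ×-dec p ≟ suc (suc (suc zero)))))} tt
    ... | inj₁ p≡q                  = p≡q
    ... | inj₂ (inj₁ (refl , refl)) = contradiction e c≢c′
    ... | inj₂ (inj₂ (refl , refl)) = contradiction (sym e) c≢c′

    surjective : ∀ v → ∃ λ p → h p ≡ v
    surjective v with allowed v
    ... | inj₁ (zero , eq)             = zero , size-1 (sized (specials zero)) (proj₂ a-exists) (fromWitness eq)
    ... | inj₁ (suc zero , eq)         = suc zero , size-1 (sized (specials (suc zero))) (proj₂ b-exists) (fromWitness eq)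
    ... | inj₂ δ                       = contradiction (v , δ) no-Δ
    ... | inj₁ (suc (suc zero) , eq)   =
          [ (λ e → suc (suc zero) , sym e) , (λ e → suc (suc (suc zero)) , sym e) ]′
          (size-2 (sized (specials (suc (suc zero)))) (proj₂ c-exists) (proj₂ (proj₂ c-other)) c≢c′ v (fromWitness eq))

    g : V → Fin 4
    g v = proj₁ (surjective v)
    h∘g : ∀ v → h (g v) ≡ v
    h∘g v = proj₂ (surjective v)

    counts : ∀ j p → count (λ q → edge j (h p) (h q)) ≡ count (ColouredGraph.edge Kᶜ j p)
    counts j p = trans (count-⤖ h (λ _ e → e) (λ _ _ → h-injective _ _)
        (λ v e → g v , subst (E Fᶜ j (h p)) (sym (h∘g v)) e , h∘g v)) (at j)
      where
      at : ∀ j → d j (h p) ≡ count (ColouredGraph.edge Kᶜ j p)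
      at zero       = first-entry (h-degree p)
      at (suc zero) = second-entry (h-degree p)

    F⊆K : ∀ {j p} → (∀ q → E Fᶜ j (h p) (h q) → E Kᶜ j p q) → ∀ q → E Kᶜ j p q → E Fᶜ j (h p) (h q)
    F⊆K {j} {p} f = count-⊆-≡ f (counts j p)

    K⊆F : ∀ {j p} → (∀ q → E Kᶜ j p q → E Fᶜ j (h p) (h q)) → ∀ q → E Fᶜ j (h p) (h q) → E Kᶜ j p q
    K⊆F {j} {p} f = count-⊆-≡ f (sym (counts j p))

    -- There are only three vertices besides `a`, which has three neighbours of the first colour.
    row-a : ∀ q → E Kᶜ c₀ zero q → E Fᶜ c₀ a (h q)
    row-a = F⊆K λ { zero e → irrefl c₀ a e ; (suc q) e → tt }

    -- The two neighbours of `b` in the second colour avoid `a`, which has none in it, so they are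
    -- `c` and `c′`.
    row-b : ∀ q → E Kᶜ c₁ (suc zero) q → E Fᶜ c₁ b (h q)
    row-b = F⊆K λ { zero e → nonzero (flip e) (sized (second-entry a-degree)) ; (suc zero) e → irrefl c₁ b e ; (suc (suc q)) e → tt }

    K⇒F : ∀ j p q → E Kᶜ j p q → E Fᶜ j (h p) (h q)
    K⇒F zero       zero          q             = row-a q
    K⇒F zero       (suc p)       zero          = λ _ → flip (row-a (suc p) tt)
    K⇒F zero       (suc p)       (suc q)       = λ ()
    K⇒F (suc zero) zero          q             = λ ()
    K⇒F (suc zero) (suc zero)    q             = row-b q
    K⇒F (suc zero) (suc (suc p)) zero          = λ ()
    K⇒F (suc zero) (suc (suc p)) (suc zero)    = λ _ → flip (row-b (suc (suc p)) tt)
    K⇒F (suc zero) (suc (suc p)) (suc (suc q)) = λ ()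

    F⇒K : ∀ j p q → E Fᶜ j (h p) (h q) → E Kᶜ j p q
    -- All edges of `Kᶜ` being present, the equal degrees leave no room for further ones.
    F⇒K j p = K⊆F (K⇒F j p)

-- Induction on the number `n` of vertices, which each contraction lowers by one.
subdivision : ∀ {p q} → Adj (complete 4) p q → ∀ n Fᶜ → ColouredGraph.order Fᶜ ≡ n → Profile Fᶜ →
              𝒮 (K₄-e p q) (underlying Fᶜ)
subdivision pq n Fᶜ eq prof with any? (λ x → any? λ i → colouredDegree Fᶜ x ≟ᵈ (replicate 2 0 [ i ]≔ 2))
subdivision {p} {q} pq n Fᶜ eq prof | no no-Δ =
  base (≅-trans (≅-sym (Kᶜ≅K₄-e p q pq)) (underlying-≅ (Kᶜ≅ Fᶜ prof no-Δ)))
subdivision pq zero Fᶜ@record { order = zero } refl prof | yes (() , _)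
subdivision pq (suc n) Fᶜ eq prof | yes δ with contract Fᶜ eq (Δ-contractible Fᶜ prof δ)
... | Gᶜ , eq′ , i , u , v , uv , φ =
  subdivide (subdivision pq n Gᶜ eq′ (⇐ (Profile-subdivideᶜ Gᶜ i u v uv) (Profile-resp-≅ᶜ (≅ᶜ-sym φ) prof)))
    u v (⇐ (adj⇔edge Gᶜ u v) (i , uv))
    (≅-trans (≅-sym (underlying-subdivideᶜ Gᶜ i u v)) (underlying-≅ φ))

extendedProfile : ∀ u v → Adj (complete 4) u v → IsExtendedProfile M (𝒮 (K₄-e u v))
extendedProfile u v uv F = mk⇔
  (λ s → let Fᶜ , φ , p = coloured Kᶜ (Kᶜ≅K₄-e u v uv) Profile-Kᶜ s in Fᶜ , φ , ⇐ (𝒞*⇔Profile Fᶜ) p)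
  (λ { (Fᶜ , φ , h) → 𝒮-resp-≅ (subdivision uv _ Fᶜ refl (⇒ (𝒞*⇔Profile Fᶜ) h)) φ })

-- Decision diagrams

record Quotient {K} (_≈_ : Fin K → Fin K → Set) : Set where
  field
    size      : ℕ
    rep       : Fin size → Fin K
    class     : Fin K → Fin size
    rep-class : ∀ x → rep (class x) ≈ x
    distinct  : ∀ {p q} → rep p ≈ rep q → p ≡ q

-- Representatives are chosen greedily from the last element to the first: an element becomes one
-- only if it is related to none chosen so far.
quotientBy : ∀ {K} {_≈_ : Fin K → Fin K → Set} → (∀ x → x ≈ x) → (∀ {x y} → x ≈ y → y ≈ x) →
             (∀ x y → Dec (x ≈ y)) → Quotient _≈_
quotientBy {zero} _ _ _ = record
  { size = 0 ; rep = λ () ; class = λ () ; rep-class = λ () ; distinct = λ { {()} } }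
quotientBy {suc K} {_≈_} ≈-refl ≈-sym _≈?_
  with quotientBy {K} {λ x y → suc x ≈ suc y} (λ x → ≈-refl (suc x)) ≈-sym (λ x y → suc x ≈? suc y)
... | Q with any? (λ p → suc (Quotient.rep Q p) ≈? zero)
...   | yes (p , p≈0) = record
  { size      = size
  ; rep       = suc ∘ rep
  ; class     = λ { zero → p ; (suc x) → class x }
  ; rep-class = λ { zero → p≈0 ; (suc x) → rep-class x }
  ; distinct  = distinct
  }
  where open Quotient Q
...   | no none = record
  { size      = suc size
  ; rep       = λ { zero → zero ; (suc p) → suc (rep p) }
  ; class     = λ { zero → zero ; (suc x) → suc (class x) }
  ; rep-class = λ { zero → ≈-refl zero ; (suc x) → rep-class x }
  ; distinct  = λ { {zero}  {zero}  _ → refl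
                  ; {zero}  {suc q} e → contradiction (q , ≈-sym e) none
                  ; {suc p} {zero}  e → contradiction (p , e) none
                  ; {suc p} {suc q} e → cong suc (distinct e) }
  }
  where open Quotient Q

-- The colour of every edge, where zero stands for an edge that is not chosen.
Assignment : ℕ → ℕ → Set
Assignment c m = Fin m → Fin (suc c)

module _ {c m : ℕ} where
  -- Prefixes and completions are both total assignments, read below and from position `i`, so no
  -- type depends on the level.
  splice : ℕ → Assignment c m → Assignment c m → Assignment c m
  splice i P s k = if ⌊ toℕ k ℕ.<? i ⌋ then P k else s k

  splice-< : ∀ {i} P s {k} → toℕ k < i → splice i P s k ≡ P k
  splice-< {i} P s {k} k<i with toℕ k ℕ.<? i
  ... | yes _  = refl
  ... | no k≮i = contradiction k<i k≮i

  splice-≥ : ∀ {i} P s {k} → i ≤ toℕ k → splice i P s k ≡ s k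
  splice-≥ {i} P s {k} i≤k with toℕ k ℕ.<? i
  ... | yes k<i = contradiction i≤k (ℕ.<⇒≱ k<i)
  ... | no _    = refl

  splice-congʳ : ∀ i P {s t} → s ≗ t → splice i P s ≗ splice i P t
  splice-congʳ i P s≗t k with toℕ k ℕ.<? i
  ... | yes _ = refl
  ... | no _  = s≗t k

  splice-congˡ : ∀ i {P Q} s → P ≗ Q → splice i P s ≗ splice i Q s
  splice-congˡ i s P≗Q k with toℕ k ℕ.<? i
  ... | yes _ = P≗Q k
  ... | no _  = refl

  update : Assignment c m → Fin m → Fin (suc c) → Assignment c m
  update P i v k = if ⌊ k ≟ i ⌋ then v else P k

  update-at : ∀ P i v → update P i v i ≡ v
  update-at P i v with i ≟ i
  ... | yes _  = refl
  ... | no i≢i = contradiction refl i≢i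

  update-≢ : ∀ P i v {k} → k ≢ i → update P i v k ≡ P k
  update-≢ P i v {k} k≢i with k ≟ i
  ... | yes k≡i = contradiction k≡i k≢i
  ... | no _    = refl

  update-same : ∀ P i {v} → P i ≡ v → update P i v ≗ P
  update-same P i eq k with k ≟ i
  ... | yes refl = sym eq
  ... | no _     = refl

  splice-step : ∀ i P s → splice (suc (toℕ i)) P s ≗ splice (toℕ i) P (update s i (P i))
  splice-step i P s k with ℕ.<-cmp (toℕ k) (toℕ i)
  ... | tri< k<i _ _ = trans (splice-< P s (ℕ.m<n⇒m<1+n k<i)) (sym (splice-< P (update s i (P i)) k<i))
  ... | tri> _ k≢i i<k = trans (splice-≥ P s i<k)
        (sym (trans (splice-≥ P (update s i (P i)) (ℕ.<⇒≤ i<k)) (update-≢ s i (P i) (k≢i ∘ cong toℕ))))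
  ... | tri≈ _ k≡i _ with toℕ-injective k≡i
  ...   | refl = trans (splice-< P s ℕ.≤-refl) (sym (trans (splice-≥ P (update s i (P i)) ℕ.≤-refl) (update-at s i (P i))))

  -- Extending a prefix amounts to fixing the next entry of its completions. This makes residuals
  -- compatible with arcs.
  splice-update : ∀ i P v s → splice (suc (toℕ i)) (update P i v) s ≗ splice (toℕ i) P (update s i v)
  splice-update i P v s k = trans (splice-step i (update P i v) s k)
    (trans (splice-congʳ (toℕ i) (update P i v)
             (λ k → cong (λ u → update s i u k) (update-at P i v)) k) (restore k))
    where
    restore : splice (toℕ i) (update P i v) (update s i v) ≗ splice (toℕ i) P (update s i v)
    restore k with toℕ k ℕ.<? toℕ i
    ... | yes k<i = update-≢ P i v λ { refl → ℕ.<-irrefl refl k<i }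
    ... | no _    = refl

  assignment : ColouredSubset c m → Assignment c m
  assignment D k with any? (λ j → k ∈? ColouredSubset.part D j)
  ... | yes (j , _) = suc j
  ... | no _        = zero

  assignment⇔ : ∀ D j k → assignment D k ≡ suc j ⇔ k ∈ ColouredSubset.part D j
  assignment⇔ D j k with any? (λ j → k ∈? ColouredSubset.part D j)
  ... | yes (j′ , k∈) = mk⇔ (λ { refl → k∈ }) (λ k∈′ → cong suc (ColouredSubset.disjoint D k∈ k∈′))
  ... | no ¬k∈        = mk⇔ (λ ()) (λ k∈ → contradiction (j , k∈) ¬k∈)

-- The Myhill–Nerode construction: the nodes at level i are the prefixes of length i up to having
-- the same accepted completions. Any code that refines this equivalence bounds the width.
module Nerode {c m : ℕ} (accept : Assignment c (suc m) → Bool)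
              (accept-cong : ∀ {s t} → s ≗ t → accept s ≡ accept t) where

  private
    A : Set
    A = Assignment c (suc m)

    -- Pairs of a level and a total assignment are coded by single numbers, so that the quotient is
    -- taken of one finite set.
    K : ℕ
    K = suc m * suc c ^ suc m

    levelᴷ : Fin K → Fin (suc m)
    levelᴷ = quotient (suc c ^ suc m)

    prefixᴷ : Fin K → A
    prefixᴷ x = finToFun (remainder {suc m} (suc c ^ suc m) x)

    node : Fin (suc m) → A → Fin K
    node i P = combine i (funToFin P)

    level-node : ∀ i P → levelᴷ (node i P) ≡ i
    level-node i P = cong proj₁ (remQuot-combine i (funToFin P))

    prefix-node : ∀ i P → prefixᴷ (node i P) ≗ P
    prefix-node i P k = trans (cong (λ x → finToFun (proj₂ x) k) (remQuot-combine i (funToFin P)))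
                              (finToFun-funToFin P k)

  -- The residual language of a prefix; the entries of `s` below the level have no effect.
  residual : Fin (suc m) → A → A → Bool
  residual i P s = accept (splice (toℕ i) P s)

  private
    residual-cong : ∀ i P {s t} → s ≗ t → residual i P s ≡ residual i P t
    residual-cong i P e = accept-cong (splice-congʳ (toℕ i) P e)

    record _≈_ (x y : Fin K) : Set where
      constructor _,_
      field
        same-level    : levelᴷ x ≡ levelᴷ y
        same-residual : ∀ z → residual (levelᴷ x) (prefixᴷ x) (finToFun z) ≡
                              residual (levelᴷ y) (prefixᴷ y) (finToFun z)

    _≈?_ : ∀ x y → Dec (x ≈ y)
    x ≈? y = map′ (λ (p , q) → p , q) (λ (p , q) → p , q) ((levelᴷ x ≟ levelᴷ y) ×-dec
      all? λ z → residual (levelᴷ x) (prefixᴷ x) (finToFun z) Bool.≟ residual (levelᴷ y) (prefixᴷ y) (finToFun z))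

    Q : Quotient _≈_
    Q = quotientBy (λ x → refl , λ _ → refl) (λ (p , q) → sym p , λ z → sym (q z)) _≈?_

    open Quotient Q using (rep)

  -- From here on the quotient is known only through `level-class`, `prefix-class` and `distinct`.
  abstract
    size : ℕ
    size = Quotient.size Q

    level : Fin size → Fin (suc m)
    level = levelᴷ ∘ rep

    prefix : Fin size → A
    prefix = prefixᴷ ∘ rep

    class : Fin (suc m) → A → Fin size
    class i P = Quotient.class Q (node i P)

    level-class : ∀ i P → level (class i P) ≡ i
    level-class i P = trans (_≈_.same-level (Quotient.rep-class Q (node i P))) (level-node i P)

    prefix-class : ∀ i P s → residual i (prefix (class i P)) s ≡ residual i P s
    prefix-class i P s = trans (residual-cong i _ (sym ∘ finToFun-funToFin s)) (trans
      (trans (subst (λ l → residual l (prefix (class i P)) t ≡ residual (levelᴷ (node i P)) (prefixᴷ (node i P)) t)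
               (level-class i P)
               (_≈_.same-residual (Quotient.rep-class Q (node i P)) (funToFin s)))
        (trans (cong (λ l → residual l (prefixᴷ (node i P)) t) (level-node i P))
               (accept-cong (splice-congˡ (toℕ i) t (prefix-node i P)))))
      (residual-cong i P (finToFun-funToFin s)))
      where
      t : A
      t = finToFun (funToFin s)

    distinct : ∀ {p q} → level p ≡ level q →
               (∀ s → residual (level p) (prefix p) s ≡ residual (level p) (prefix q) s) → p ≡ q
    distinct {p} {q} l r = Quotient.distinct Q (l , λ z → trans (r (finToFun z))
      (cong (λ l → residual l (prefix q) (finToFun z)) l))

  extend : Fin size → Fin (suc c) → A
  extend α k = update (prefix α) (level α) k

  -- A prefix without accepted completion is not sent to `⊥ₙ` early. Its class is an ordinary node,
  -- and only the last level leads to the terminals.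
  arc : Fin size → Fin (suc c) → Node size
  arc α k with suc (toℕ (level α)) ℕ.<? suc m
  ... | yes l<m = inner (class (fromℕ< l<m) (extend α k))
  ... | no _    = if accept (extend α k) then ⊤ₙ else ⊥ₙ

  data Arc (α : Fin size) (k : Fin (suc c)) : Node size → Set where
    to-inner : ∀ i → toℕ i ≡ suc (toℕ (level α)) → Arc α k (inner (class i (extend α k)))
    to-⊤     : suc (toℕ (level α)) ≡ suc m → T (accept (extend α k)) → Arc α k ⊤ₙ
    to-⊥     : suc (toℕ (level α)) ≡ suc m → ¬ T (accept (extend α k)) → Arc α k ⊥ₙ

  arc-view : ∀ α k → Arc α k (arc α k)
  arc-view α k with suc (toℕ (level α)) ℕ.<? suc m
  ... | yes l<m = to-inner (fromℕ< l<m) (toℕ-fromℕ< l<m)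
  ... | no l≮m  with accept (extend α k) in eq
  ...   | true  = to-⊤ (ℕ.≤-antisym (toℕ<n (level α)) (ℕ.≮⇒≥ l≮m)) (subst T (sym eq) tt)
  ...   | false = to-⊥ (ℕ.≤-antisym (toℕ<n (level α)) (ℕ.≮⇒≥ l≮m)) (subst T eq)

  root : Fin size
  root = class zero (λ _ → zero)

  arc-level : ∀ {α k β} → arc α k ≡ inner β → toℕ (level β) ≡ suc (toℕ (level α))
  arc-level {α} {k} eq with arc α k | arc-view α k
  arc-level refl | _ | to-inner i e = trans (cong toℕ (level-class i _)) e

  residual-extend : ∀ α k s → accept (splice (suc (toℕ (level α))) (extend α k) s) ≡
                              residual (level α) (prefix α) (update s (level α) k)
  residual-extend α k s = accept-cong (splice-update (level α) (prefix α) k s)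

  arc-into : ∀ α k β → toℕ (level β) ≡ suc (toℕ (level α)) →
             (∀ s → residual (level α) (prefix α) (update s (level α) k) ≡ residual (level β) (prefix β) s) →
             arc α k ≡ inner β
  arc-into α k β eq same with arc α k | arc-view α k
  ... | _ | to-⊤ e _ = contradiction (trans eq e) (ℕ.<⇒≢ (toℕ<n (level β)))
  ... | _ | to-⊥ e _ = contradiction (trans eq e) (ℕ.<⇒≢ (toℕ<n (level β)))
  ... | _ | to-inner i e = cong inner (distinct (trans (level-class i P) i≡) λ s → begin
      residual (level (class i P)) (prefix (class i P)) s ≡⟨ cong (λ l → residual l (prefix (class i P)) s) (level-class i P) ⟩
      residual i (prefix (class i P)) s                   ≡⟨ prefix-class i P s ⟩
      accept (splice (toℕ i) P s)                         ≡⟨ cong (λ l → accept (splice l P s)) e ⟩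
      accept (splice (suc (toℕ (level α))) P s)           ≡⟨ residual-extend α k s ⟩
      residual (level α) (prefix α) (update s (level α) k) ≡⟨ same s ⟩
      residual (level β) (prefix β) s                     ≡⟨ cong (λ l → residual l (prefix β) s) (sym (trans (level-class i P) i≡)) ⟩
      residual (level (class i P)) (prefix β) s           ∎)
    where
    open ≡-Reasoning
    P : A
    P = extend α k
    i≡ : i ≡ level β
    i≡ = toℕ-injective (trans e (sym eq))

  -- The predecessor is the class of the same assignment read one position less. Every node beyond
  -- level zero thus has an incoming arc, as `root-unique` demands.
  arc-to : ∀ i β → toℕ (level β) ≡ suc (toℕ i) → arc (class i (prefix β)) (prefix β i) ≡ inner β
  arc-to i β eq = arc-into α (prefix β i) β (trans eq (cong (suc ∘ toℕ) (sym (level-class i (prefix β))))) λ s → begin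
    residual (level α) (prefix α) (update s (level α) (prefix β i))
      ≡⟨ cong (λ l → residual l (prefix α) (update s l (prefix β i))) (level-class i (prefix β)) ⟩
    residual i (prefix α) (update s i (prefix β i))    ≡⟨ prefix-class i (prefix β) _ ⟩
    residual i (prefix β) (update s i (prefix β i))    ≡⟨ accept-cong (sym ∘ splice-step i (prefix β) s) ⟩
    accept (splice (suc (toℕ i)) (prefix β) s)         ≡⟨ cong (λ l → accept (splice l (prefix β) s)) (sym eq) ⟩
    residual (level β) (prefix β) s                    ∎
    where
    open ≡-Reasoning
    α : Fin size
    α = class i (prefix β)

  residual-0 : ∀ i P s → toℕ i ≡ 0 → residual i P s ≡ accept s
  residual-0 i P s e = accept-cong λ y → splice-≥ P s (subst (_≤ toℕ y) (sym e) z≤n)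

  level-root : toℕ (level root) ≡ 0
  level-root = cong toℕ (level-class zero (λ _ → zero))

  -- At level zero the residual ignores the prefix, so there is just one class.
  root-or-target : ∀ β → root ≡ β ⊎ ∃₂ λ α k → arc α k ≡ inner β
  root-or-target β with level β in eq
  ... | zero  = inj₁ (distinct (toℕ-injective (trans level-root (cong toℕ (sym eq)))) λ s →
          trans (residual-0 (level root) (prefix root) s level-root)
                (sym (residual-0 (level root) (prefix β) s level-root)))
  ... | suc i = inj₂ (_ , _ , arc-to (Fin.inject₁ i) β (trans (cong toℕ eq) (cong suc (sym (toℕ-inject₁ i)))))

  root-unique : ∀ β → inner root ≡ inner β ⇔ (∀ α k → arc α k ≢ inner β)
  root-unique β = mk⇔
    (λ { refl α k eq → case trans (sym (arc-level eq)) level-root of λ () })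
    (λ no-arc → [ cong inner , (λ (α , k , eq) → contradiction eq (no-arc α k)) ]′ (root-or-target β))

  diagram : DD c (suc m)
  diagram = record
    { size        = size
    ; label       = level
    ; arc         = arc
    ; root        = inner root
    ; arc-label   = arc-level
    ; root-unique = root-unique
    }

  open DD diagram using (Path; end; step; uses; uses->; ⟦_⟧; width)

  uses-step : ∀ α k (p : Path (arc α k)) j {y} →
              y ∈ uses (step α k p) j ⇔ ((k ≡ suc j × y ≡ level α) ⊎ y ∈ uses p j)
  uses-step α k p j {y} with k ≟ suc j
  ... | no k≢  = mk⇔ inj₂ [ (λ (k≡ , _) → contradiction k≡ k≢) , id ]′
  ... | yes k≡ = mk⇔
    (λ y∈ → [ (λ y∈α → inj₁ (k≡ , x∈⁅y⁆⇒x≡y (level α) y∈α)) , inj₂ ]′ (x∈p∪q⁻ ⁅ level α ⁆ (uses p j) y∈))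
    [ (λ { (_ , refl) → x∈p∪q⁺ (inj₁ (x∈⁅x⁆ (level α))) }) , (λ y∈ → x∈p∪q⁺ (inj₂ y∈)) ]′

  Follows : ℕ → ∀ {x} → Path x → A → Set
  Follows i p s = ∀ j y → y ∈ uses p j ⇔ (i ≤ toℕ y × s y ≡ suc j)

  follows-step : ∀ α k (p : Path (arc α k)) s →
    Follows (toℕ (level α)) (step α k p) s ⇔ (s (level α) ≡ k × Follows (suc (toℕ (level α))) p s)
  follows-step α k p s = mk⇔ (λ f → colour f k refl , tail f) (λ (e , f) → cons e f)
    where
    l : Fin (suc m)
    l = level α

    colour : Follows (toℕ l) (step α k p) s → ∀ k′ → k ≡ k′ → s l ≡ k′
    colour f (suc j) refl = proj₂ (⇒ (f j l) (⇐ (uses-step α k p j) (inj₁ (refl , refl))))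
    -- A 0-arc records nothing. If `s` coloured this edge, the rest of the path would have to use
    -- it, but that part only uses later edges.
    colour f zero refl with s l in eq
    ... | zero  = refl
    ... | suc j with ⇒ (uses-step α k p j) (⇐ (f j l) (ℕ.≤-refl , eq))
    ...   | inj₂ l∈p = contradiction (uses-> p j l∈p) (ℕ.<-irrefl refl)

    tail : Follows (toℕ l) (step α k p) s → Follows (suc (toℕ l)) p s
    tail f j y = mk⇔
      (λ y∈p → uses-> p j y∈p , proj₂ (⇒ (f j y) (⇐ (uses-step α k p j) (inj₂ y∈p))))
      (λ (l<y , e) → [ (λ { (_ , refl) → contradiction l<y (ℕ.<-irrefl refl) }) , id ]′
                       (⇒ (uses-step α k p j) (⇐ (f j y) (ℕ.<⇒≤ l<y , e))))

    cons : s l ≡ k → Follows (suc (toℕ l)) p s → Follows (toℕ l) (step α k p) s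
    cons e f j y = mk⇔
      (λ y∈ → [ (λ { (k≡ , refl) → ℕ.≤-refl , trans e k≡ })
              , (λ y∈p → let l<y , e′ = ⇒ (f j y) y∈p in ℕ.<⇒≤ l<y , e′) ]′ (⇒ (uses-step α k p j) y∈))
      (λ (l≤y , e′) → ⇐ (uses-step α k p j) (case toℕ y ℕ.≟ toℕ l of λ
        { (yes y≡l) → let y≡ = toℕ-injective y≡l in inj₁ (trans (sym e) (trans (cong s (sym y≡)) e′) , y≡)
        ; (no y≢l)  → inj₂ (⇐ (f j y) (ℕ.≤∧≢⇒< l≤y (y≢l ∘ sym) , e′)) }))

  residual-step : ∀ α s → residual (level α) (prefix α) s ≡
                          accept (splice (suc (toℕ (level α))) (extend α (s (level α))) s)
  residual-step α s = trans (residual-cong (level α) (prefix α) (sym ∘ update-same s (level α) refl))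
                            (sym (residual-extend α (s (level α)) s))

  residual-class : ∀ i α k s → toℕ i ≡ suc (toℕ (level α)) →
    residual (level (class i (extend α k))) (prefix (class i (extend α k))) s ≡
    accept (splice (suc (toℕ (level α))) (extend α k) s)
  residual-class i α k s e = trans (cong (λ l → residual l (prefix (class i (extend α k))) s) (level-class i _))
    (trans (prefix-class i (extend α k) s) (cong (λ l → accept (splice l (extend α k) s)) e))

  residual-end : ∀ α k s → suc (toℕ (level α)) ≡ suc m →
                 accept (splice (suc (toℕ (level α))) (extend α k) s) ≡ accept (extend α k)
  residual-end α k s e = accept-cong λ y → splice-< (extend α k) s (subst (toℕ y <_) (sym e) (toℕ<n y))

  path⇒accept : ∀ {x} (p : Path x) {α} → x ≡ inner α → ∀ s → Follows (toℕ (level α)) p s →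
                T (residual (level α) (prefix α) s)
  path⇒accept (step α k p) refl s f with ⇒ (follows-step α k p s) f
  ... | refl , g = subst T (sym (residual-step α s)) (go (arc-view α k) refl)
    where
    go : ∀ {x} → Arc α k x → arc α k ≡ x → T (accept (splice (suc (toℕ (level α))) (extend α k) s))
    go (to-inner i e) eq = subst T (residual-class i α k s e) (path⇒accept p eq s
      (subst (λ l → Follows l p s) (sym (trans (cong toℕ (level-class i _)) e)) g))
    go (to-⊤ e acc) eq = subst T (sym (residual-end α k s e)) acc
    go (to-⊥ e _) eq = case subst Path eq p of λ ()

  uses-subst : ∀ {x y} (eq : x ≡ y) (p : Path x) j → uses (subst Path eq p) j ≡ uses p j
  uses-subst refl p j = refl

  -- `fuel` is the number of levels left; it cannot be zero, since no node lies beyond the last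
  -- level.
  accept⇒path : ∀ fuel α → fuel + toℕ (level α) ≡ suc m → ∀ s → T (residual (level α) (prefix α) s) →
                ∃ λ (p : Path (inner α)) → Follows (toℕ (level α)) p s
  accept⇒path zero α eq s _ = contradiction eq (ℕ.<⇒≢ (toℕ<n (level α)))
  accept⇒path (suc fuel) α eq s acc =
    let p , f = go (arc-view α k) refl in step α k p , ⇐ (follows-step α k p s) (refl , f)
    where
    k : Fin (suc c)
    k = s (level α)

    acc′ : T (accept (splice (suc (toℕ (level α))) (extend α k) s))
    acc′ = subst T (residual-step α s) acc

    go : ∀ {x} → Arc α k x → arc α k ≡ x → ∃ λ (p : Path (arc α k)) → Follows (suc (toℕ (level α))) p s
    go (to-inner i e) eq′ =
      let next     = class i (extend α k)
          level-eq = trans (cong toℕ (level-class i (extend α k))) e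
          p , f    = accept⇒path fuel next (trans (cong (fuel +_) level-eq) (trans (ℕ.+-suc fuel _) eq)) s
                       (subst T (sym (residual-class i α k s e)) acc′)
      in subst Path (sym eq′) p , λ j y →
         subst₂ (λ l u → y ∈ u ⇔ (l ≤ toℕ y × s y ≡ suc j)) level-eq (sym (uses-subst (sym eq′) p j)) (f j y)
    go (to-⊤ e _) eq′ = subst Path (sym eq′) end , λ j y →
      subst (λ u → y ∈ u ⇔ (suc (toℕ (level α)) ≤ toℕ y × s y ≡ suc j)) (sym (uses-subst (sym eq′) end j))
        (mk⇔ (λ y∈ → contradiction y∈ ∉⊥)
             (λ (l<y , _) → contradiction (subst (_≤ toℕ y) e l<y) (ℕ.<⇒≱ (toℕ<n y))))
    go (to-⊥ e ¬acc) eq′ = contradiction (subst T (residual-end α k s e) acc′) ¬acc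

  represents : Represents diagram (λ D → T (accept (assignment D)))
  represents D = mk⇔
    (λ acc → let p , f = accept⇒path (suc m) root (trans (cong (suc m +_) level-root) (ℕ.+-identityʳ _)) s
                           (subst T (sym root-residual) acc)
             in p , λ j → ⊆-antisym
               (λ {y} y∈ → ⇒ (assignment⇔ D j y) (proj₂ (⇒ (f j y) y∈)))
               (λ {y} y∈ → ⇐ (f j y) (subst (_≤ toℕ y) (sym level-root) z≤n , ⇐ (assignment⇔ D j y) y∈)))
    (λ (p , eq) → subst T root-residual (path⇒accept p refl s λ j y → mk⇔
      (λ y∈ → subst (_≤ toℕ y) (sym level-root) z≤n , ⇐ (assignment⇔ D j y) (subst (y ∈_) (eq j) y∈))
      (λ (_ , e) → subst (y ∈_) (sym (eq j)) (⇒ (assignment⇔ D j y) e))))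
    where
    s : A
    s = assignment D
    root-residual : residual (level root) (prefix root) s ≡ accept s
    root-residual = residual-0 (level root) (prefix root) s level-root

  width-≤ : ∀ {w} (N : Fin (suc m) → ℕ) (code : ∀ i → A → Fin (N i)) →
            (∀ i {P Q} → code i P ≡ code i Q → ∀ s → residual i P s ≡ residual i Q s) →
            (∀ i → N i ≤ w) → width ≤ w
  width-≤ N code sound N≤w = max≤v⁺ z≤n (All.map⁺ (All.tabulate⁺ λ i →
    ℕ.≤-trans (ℕ.≤-reflexive (count-length (λ α → level α ≟ i)))
      (ℕ.≤-trans (injective⇒≤ {f = codeAt i} (codeAt-injective i)) (N≤w i))))
    where
    module At (i : Fin (suc m)) = Enumeration (enumerate (λ α → ⌊ level α ≟ i ⌋))
    codeAt : ∀ i → Fin (count (λ α → ⌊ level α ≟ i ⌋)) → Fin (N i)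
    codeAt i p = code i (prefix (At.at i p))
    at-level : ∀ i p → level (At.at i p) ≡ i
    at-level i p = toWitness (At.at-true i p)
    codeAt-injective : ∀ i {p q} → codeAt i p ≡ codeAt i q → p ≡ q
    codeAt-injective i {p} {q} eq = At.at-inj i (distinct (trans (at-level i p) (sym (at-level i q))) λ s →
      subst (λ l → residual l (prefix (At.at i p)) s ≡ residual l (prefix (At.at i q)) s)
        (sym (at-level i p)) (sound i eq s))

-- Coloured edge lists cut at a frontier

-- Labels serve twice: they decide connectivity, and they are what `Code` turns into a description
-- of the components.
record Labelling {n} (R : Fin n → Fin n → Set) : Set where
  field
    lab  : Fin n → Fin n
    lab⇔ : ∀ x y → lab x ≡ lab y ⇔ Star R x y

  star? : ∀ x y → Dec (Star R x y)
  star? x y = map′ (⇒ (lab⇔ x y)) (⇐ (lab⇔ x y)) (lab x ≟ lab y)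

Selected : ∀ {m n} (src tgt : Fin m → Fin n) → (Fin m → Bool) → Fin n → Fin n → Set
Selected src tgt sel u v = ∃ λ k → T (sel k) × SameEnds (src k) (tgt k) u v

-- Union–find: the edges are added one by one, and the label of one end replaces that of the other.
labelling : ∀ {m n} (src tgt : Fin m → Fin n) (sel : Fin m → Bool) → Labelling (Selected src tgt sel)
labelling {zero} src tgt sel = record
  { lab = id ; lab⇔ = λ x y → mk⇔ (λ { refl → ε }) (λ { ε → refl ; ((() , _) ◅ _) }) }
labelling {suc m} {n} src tgt sel with sel zero in eq | labelling (src ∘ suc) (tgt ∘ suc) (sel ∘ suc)
... | false | rest = record
  { lab  = lab
  ; lab⇔ = λ x y → mk⇔
      (λ e → Star.map (λ (k , t , s) → suc k , t , s) (⇒ (lab⇔ x y) e))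
      (λ p → ⇐ (lab⇔ x y) (Star.map (λ { (zero , t , s) → ⊥-elim (subst T eq t) ; (suc k , t , s) → k , t , s }) p))
  }
  where open Labelling rest
... | true | rest = record { lab = merge ∘ lab ; lab⇔ = λ x y → mk⇔ connect same }
  where
  open Labelling rest

  u v : Fin n
  u = src zero
  v = tgt zero

  R : Fin n → Fin n → Set
  R = Selected src tgt sel

  merge : Fin n → Fin n
  merge ℓ = if ⌊ ℓ ≟ lab v ⌋ then lab u else ℓ

  old : ∀ {x y} → lab x ≡ lab y → Star R x y
  old e = Star.map (λ (k , t , s) → suc k , t , s) (⇒ (lab⇔ _ _) e)

  v→u : Star R v u
  v→u = (zero , subst T (sym eq) tt , inj₂ (refl , refl)) ◅ ε

  u→v : Star R u v
  u→v = (zero , subst T (sym eq) tt , inj₁ (refl , refl)) ◅ ε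

  connect : ∀ {x y} → merge (lab x) ≡ merge (lab y) → Star R x y
  connect {x} {y} e with lab x ≟ lab v | lab y ≟ lab v
  ... | yes p | yes q = old (trans p (sym q))
  ... | yes p | no _  = old p ◅◅ v→u ◅◅ old e
  ... | no _  | yes q = old e ◅◅ u→v ◅◅ old (sym q)
  ... | no _  | no _  = old e

  merge-ends : merge (lab u) ≡ merge (lab v)
  merge-ends with lab u ≟ lab v | lab v ≟ lab v
  ... | _     | no ¬p = contradiction refl ¬p
  ... | yes _ | yes _ = refl
  ... | no _  | yes _ = refl

  step : ∀ {x y} → R x y → merge (lab x) ≡ merge (lab y)
  step (zero , _ , inj₁ (refl , refl)) = merge-ends
  step (zero , _ , inj₂ (refl , refl)) = sym merge-ends
  step (suc k , t , s)                 = cong merge (⇐ (lab⇔ _ _) ((k , t , s) ◅ ε))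

  same : ∀ {x y} → Star R x y → merge (lab x) ≡ merge (lab y)
  same ε       = refl
  same (r ◅ p) = trans (step r) (same p)

funToFin-injective : ∀ {m n} {f g : Fin m → Fin n} → funToFin f ≡ funToFin g → f ≗ g
funToFin-injective {f = f} {g} e x =
  trans (sym (finToFun-funToFin f x)) (trans (cong (λ k → finToFun k x) e) (finToFun-funToFin g x))

mod-injective : ∀ {m n} → m < 4 → n < 4 → m mod 4 ≡ n mod 4 → m ≡ n
mod-injective m<4 n<4 e = trans (sym (toℕ-mod m<4)) (trans (cong toℕ e) (toℕ-mod n<4))
  where
  toℕ-mod : ∀ {m} → m < 4 → toℕ (m mod 4) ≡ m
  toℕ-mod m<4 = trans (toℕ-fromℕ< _) (m<n⇒m%n≡m m<4)

module EdgeList {n m : ℕ} (src tgt : Fin m → Fin n) where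

  Choice : Set
  Choice = Assignment 2 m

  Ends : Fin m → Fin n → Fin n → Set
  Ends k = SameEnds (src k) (tgt k)

  Inc : Fin n → Fin m → Set
  Inc v k = v ≡ src k ⊎ v ≡ tgt k

  inc? : ∀ v k → Dec (Inc v k)
  inc? v k = v ≟ src k ⊎-dec v ≟ tgt k

  Link : Choice → Fin 2 → Fin n → Fin n → Set
  Link s j u v = ∃ λ k → s k ≡ suc j × Ends k u v

  Touched : Choice → Fin 2 → Fin n → Set
  Touched s j v = ∃ λ k → s k ≡ suc j × Inc v k

  touched? : ∀ s j v → Dec (Touched s j v)
  touched? s j v = any? λ k → s k ≟ suc j ×-dec inc? v k

  -- Edges are counted instead of neighbours, so that the degree is a sum over the two sides of a
  -- cut. In a simple graph both counts agree, see `degree-host`.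
  deg : Choice → Fin 2 → Fin n → ℕ
  deg s j v = count λ k → ⌊ s k ≟ suc j ×-dec inc? v k ⌋

  degree : Choice → Fin n → Degree
  degree s v = tabulate λ j → deg s j v

  Connected : Choice → Fin 2 → Set
  Connected s j = ∀ u v → Touched s j u → Touched s j v → Star (Link s j) u v

  record Good (s : Choice) : Set where
    field
      specials  : ∀ t → count (λ v → ⌊ degree s v ≟ᵈ special t ⌋) ≡ multiplicity t
      allowed   : ∀ v → degree s v ≡ replicate 2 0 ⊎ Allowed (degree s v)
      connected : ∀ j → Connected s j

  labels : ∀ s j → Labelling (Link s j)
  labels s j = record
    { lab  = lab
    ; lab⇔ = λ x y → mk⇔ (Star.map (λ (k , t , e) → k , toWitness t , e) ∘ ⇒ (lab⇔ x y))
                         (⇐ (lab⇔ x y) ∘ Star.map (λ (k , t , e) → k , fromWitness t , e))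
    }
    where open Labelling (labelling src tgt (λ k → ⌊ s k ≟ suc j ⌋))

  good? : ∀ s → Dec (Good s)
  good? s = map′ (λ (a , b , c) → record { specials = a ; allowed = b ; connected = c })
                 (λ g → let open Good g in specials , allowed , connected)
    ((all? λ t → count (λ v → ⌊ degree s v ≟ᵈ special t ⌋) ℕ.≟ multiplicity t) ×-dec
     ((all? λ v → (degree s v ≟ᵈ replicate 2 0) ⊎-dec allowed? (degree s v)) ×-dec
      (all? λ j → all? λ u → all? λ v → touched? s j u →-dec (touched? s j v →-dec Labelling.star? (labels s j) u v))))

  counted⇔ : ∀ (s : Choice) j v k → T ⌊ s k ≟ suc j ×-dec inc? v k ⌋ ⇔ (s k ≡ suc j × Inc v k)
  counted⇔ s j v k = mk⇔ toWitness fromWitness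

  deg-cong : ∀ {s t : Choice} → s ≗ t → ∀ j v → deg s j v ≡ deg t j v
  deg-cong {s} {t} s≗t j v = count-cong
    (λ k e → let p , q = ⇒ (counted⇔ s j v k) e in ⇐ (counted⇔ t j v k) (trans (sym (s≗t k)) p , q))
    (λ k e → let p , q = ⇒ (counted⇔ t j v k) e in ⇐ (counted⇔ s j v k) (trans (s≗t k) p , q))

  Good-cong : ∀ {s t} → s ≗ t → Good s → Good t
  Good-cong {s} {t} s≗t g = record
    { specials  = λ r → trans (count-cong {f = λ v → ⌊ degree t v ≟ᵈ special r ⌋}
        (λ v e → fromWitness (trans (degree≡ v) (toWitness e)))
        (λ v e → fromWitness (trans (sym (degree≡ v)) (toWitness e)))) (specials r)
    ; allowed   = λ v → subst (λ d → d ≡ replicate 2 0 ⊎ Allowed d) (degree≡ v) (allowed v)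
    ; connected = λ j u v (k , e , p) (l , f , q) → Star.map (λ (k , e , r) → k , trans (sym (s≗t k)) e , r)
                    (connected j u v (k , trans (s≗t k) e , p) (l , trans (s≗t l) f , q))
    }
    where
    open Good g
    degree≡ : ∀ v → degree s v ≡ degree t v
    degree≡ v = tabulate-cong λ j → deg-cong s≗t j v

module Cut {n m : ℕ} (src tgt : Fin m → Fin n) (i : ℕ) where
  open EdgeList src tgt

  none : Choice
  none _ = zero

  before after : Choice → Choice
  before P = splice i P none
  after s = splice i none s

  before-chosen : ∀ P {k j} → before P k ≡ suc j → toℕ k < i × P k ≡ suc j
  before-chosen P {k} e with toℕ k ℕ.<? i
  ... | yes k<i = k<i , e

  after-chosen : ∀ s {k j} → after s k ≡ suc j → i ≤ toℕ k × s k ≡ suc j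
  after-chosen s {k} e with toℕ k ℕ.<? i
  ... | no k≮i = ℕ.≮⇒≥ k≮i , e

  splice-before : ∀ P s {k j} → before P k ≡ suc j → splice i P s k ≡ suc j
  splice-before P s e = let k<i , e′ = before-chosen P e in trans (splice-< P s k<i) e′

  splice-after : ∀ P s {k j} → after s k ≡ suc j → splice i P s k ≡ suc j
  splice-after P s e = let i≤k , e′ = after-chosen s e in trans (splice-≥ P s i≤k) e′

  splice-cases : ∀ P s {k j} → splice i P s k ≡ suc j →
                 (toℕ k < i × before P k ≡ suc j) ⊎ (i ≤ toℕ k × after s k ≡ suc j)
  splice-cases P s {k} e with toℕ k ℕ.<? i
  ... | yes k<i = inj₁ (k<i , e)
  ... | no k≮i  = inj₂ (ℕ.≮⇒≥ k≮i , e)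

  deg-splice : ∀ P s j v → deg (splice i P s) j v ≡ deg (before P) j v + deg (after s) j v
  deg-splice P s j v = count-+ (chosen (splice i P s)) (chosen (before P)) (chosen (after s)) pointwise
    where
    chosen : Choice → Fin m → Bool
    chosen t k = ⌊ t k ≟ suc j ×-dec inc? v k ⌋
    pointwise : ∀ k → bit (chosen (splice i P s) k) ≡ bit (chosen (before P) k) + bit (chosen (after s) k)
    pointwise k with toℕ k ℕ.<? i
    ... | yes _ = sym (ℕ.+-identityʳ _)
    ... | no _  = refl

  Before After Frontier : Fin n → Set
  Before v   = ∃ λ k → toℕ k < i × Inc v k
  After v    = ∃ λ k → i ≤ toℕ k × Inc v k
  Frontier v = Before v × After v

  before? : ∀ v → Dec (Before v)
  before? v = any? λ k → toℕ k ℕ.<? i ×-dec inc? v k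

  after? : ∀ v → Dec (After v)
  after? v = any? λ k → i ℕ.≤? toℕ k ×-dec inc? v k

  frontier? : ∀ v → Dec (Frontier v)
  frontier? v = before? v ×-dec after? v

  touched-before : ∀ P {j v} → Touched (before P) j v → Before v
  touched-before P (k , e , p) = k , proj₁ (before-chosen P e) , p

  deg-0 : ∀ s {j v} → ¬ Touched s j v → deg s j v ≡ 0
  deg-0 s {j} {v} ¬t = count-none _ λ k e → ¬t (k , ⇒ (counted⇔ s j v k) e)

  deg-≢0 : ∀ s {j v} → deg s j v ≢ 0 → Touched s j v
  deg-≢0 s {j} {v} ≢0 = decidable-stable (touched? s j v) (≢0 ∘ deg-0 s)

  touched-≢0 : ∀ s {j v} → Touched s j v → deg s j v ≢ 0
  touched-≢0 s {j} {v} (k , t) eq =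
    size-0 (sized {f = λ k → ⌊ s k ≟ suc j ×-dec inc? v k ⌋} eq) k (⇐ (counted⇔ s j v k) t)

  deg-done : ∀ P s j {v} → ¬ After v → deg (splice i P s) j v ≡ deg (before P) j v
  deg-done P s j ¬a = trans (deg-splice P s j _) (trans (cong (deg (before P) j _ +_)
    (deg-0 (after s) λ (k , e , p) → ¬a (k , proj₁ (after-chosen s e) , p))) (ℕ.+-identityʳ _))

  degree-done : ∀ P s {v} → ¬ After v → degree (splice i P s) v ≡ degree (before P) v
  degree-done P s ¬a = tabulate-cong λ j → deg-done P s j ¬a

  done : Choice → Fin 3 → Fin n → Bool
  done P t v = ⌊ ¬? (after? v) ⌋ ∧ ⌊ degree (before P) v ≟ᵈ special t ⌋

  pending : Choice → Choice → Fin 3 → Fin n → Bool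
  pending P s t v = ⌊ after? v ⌋ ∧ ⌊ degree (splice i P s) v ≟ᵈ special t ⌋

  -- A vertex with no edge after the cut already has its final degree, so its contribution depends
  -- on the prefix alone.
  count-done-pending : ∀ P s t → count (λ v → ⌊ degree (splice i P s) v ≟ᵈ special t ⌋) ≡
                                 count (done P t) + count (pending P s t)
  count-done-pending P s t = count-split after? (λ v → ⌊ degree (splice i P s) v ≟ᵈ special t ⌋)
    (λ v → ⌊ degree (before P) v ≟ᵈ special t ⌋) λ v ¬a → cong (λ d → ⌊ d ≟ᵈ special t ⌋) (degree-done P s ¬a)

  Live : Choice → Set
  Live P = ∃ λ s → Good (splice i P s)

  -- The fields hold what one direction of the transfer, from `P` to `Q`, calls for. What `Q` looks
  -- like behind the frontier is learnt from the completion in `live`.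
  record SameState (P Q : Choice) : Set where
    field
      same-degree : ∀ j {v} → Frontier v → deg (before P) j v ≡ deg (before Q) j v
      same-done   : ∀ t → count (done P t) ≡ count (done Q t)
      same-used   : ∀ j → (∃ λ k → before Q k ≡ suc j) → ∃ λ k → before P k ≡ suc j
      same-comp   : ∀ j {u v} → Frontier u → Frontier v → Star (Link (before P) j) u v →
                    Star (Link (before Q) j) u v
      live        : Live Q

  ends-inc : ∀ {k u v} → Ends k u v → Inc u k
  ends-inc (inj₁ (p , _)) = inj₁ p
  ends-inc (inj₂ (p , _)) = inj₂ p

  link-sym : ∀ {s j u v} → Link s j u v → Link s j v u
  link-sym (k , e , p) = k , e , sameEnds-sym p

  link-before : ∀ P s {j u v} → Star (Link (before P) j) u v → Star (Link (splice i P s) j) u v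
  link-before P s = Star.map λ (k , e , p) → k , splice-before P s e , p

  TouchedFrontier : Choice → Fin 2 → Fin n → Set
  TouchedFrontier P j v = Frontier v × Touched (before P) j v

  -- A walk can leave the edges before the cut only through a frontier vertex.
  walk : ∀ P s {j x y} → Star (Link (splice i P s) j) x y → Touched (before P) j x →
         (∃ λ f → TouchedFrontier P j f × Star (Link (before P) j) x f) ⊎
         (Touched (before P) j y × Star (Link (before P) j) x y)
  walk P s ε t = inj₂ (t , ε)
  walk P s {x = x} ((k , e , p) ◅ w) t with after? x
  ... | yes a = inj₁ (x , ((touched-before P t , a) , t) , ε)
  ... | no ¬a with splice-cases P s e
  ...   | inj₂ (i≤k , _) = contradiction (k , i≤k , ends-inc p) ¬a
  ...   | inj₁ (_ , e′) with walk P s w (k , e′ , ends-inc (sameEnds-sym p))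
  ...     | inj₁ (f , tf , w′) = inj₁ (f , tf , (k , e′ , p) ◅ w′)
  ...     | inj₂ (ty , w′)     = inj₂ (ty , (k , e′ , p) ◅ w′)

  module _ {P Q : Choice} (same : SameState P Q) (s : Choice) (good : Good (splice i P s)) where
    open SameState same
    private
      module G = Good good
      module G′ = Good (proj₂ live)

      s′ : Choice
      s′ = proj₁ live

    -- Without an edge before the cut both degrees are zero, so the frontier determines all degrees
    -- that can still grow.
    degree-after : ∀ {v} → After v → ∀ j → deg (before P) j v ≡ deg (before Q) j v
    degree-after {v} a j with before? v
    ... | yes b = same-degree j (b , a)
    ... | no ¬b = trans (deg-0 (before P) (¬b ∘ touched-before P)) (sym (deg-0 (before Q) (¬b ∘ touched-before Q)))

    degree-splice : ∀ {v} → After v → degree (splice i P s) v ≡ degree (splice i Q s) v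
    degree-splice {v} a = tabulate-cong λ j → trans (deg-splice P s j v)
      (trans (cong (_+ deg (after s) j v) (degree-after a j)) (sym (deg-splice Q s j v)))

    allowed : ∀ v → degree (splice i Q s) v ≡ replicate 2 0 ⊎ Allowed (degree (splice i Q s) v)
    allowed v with after? v
    ... | yes a = subst (λ d → d ≡ replicate 2 0 ⊎ Allowed d) (degree-splice a) (G.allowed v)
    ... | no ¬a = subst (λ d → d ≡ replicate 2 0 ⊎ Allowed d)
                    (trans (degree-done Q s′ ¬a) (sym (degree-done Q s ¬a))) (G′.allowed v)

    specials : ∀ t → count (λ v → ⌊ degree (splice i Q s) v ≟ᵈ special t ⌋) ≡ multiplicity t
    specials t = begin
      count (λ v → ⌊ degree (splice i Q s) v ≟ᵈ special t ⌋) ≡⟨ count-done-pending Q s t ⟩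
      count (done Q t) + count (pending Q s t)                 ≡⟨ cong₂ _+_ (sym (same-done t)) (count-≗ λ v →
         guard-cong (after? v) λ a → cong (λ d → ⌊ d ≟ᵈ special t ⌋) (sym (degree-splice a))) ⟩
      count (done P t) + count (pending P s t)                 ≡⟨ sym (count-done-pending P s t) ⟩
      count (λ v → ⌊ degree (splice i P s) v ≟ᵈ special t ⌋) ≡⟨ G.specials t ⟩
      multiplicity t                                         ∎
      where open ≡-Reasoning

    -- The ends of a nonempty walk have an edge before the cut, so they are frontier vertices and
    -- `same-comp` applies.
    before-transfer : ∀ {j x y} → After x → After y → Star (Link (before P) j) x y → Star (Link (before Q) j) x y
    before-transfer ax ay ε = ε
    before-transfer {j} ax ay w@((k , e , p) ◅ _) =
      same-comp j (first w (k , e , p) , ax) (last w , ay) w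
      where
      first : ∀ {x y z} → Star (Link (before P) j) x y → Link (before P) j x z → Before x
      first _ (k , e , p) = touched-before P (k , e , ends-inc p)
      last : ∀ {y} → Star (Link (before P) j) _ y → Before y
      last w with Star.reverse link-sym w
      ... | ε                 = first w (k , e , p)
      ... | (k′ , e′ , p′) ◅ _ = touched-before P (k′ , e′ , ends-inc p′)

    -- The walk is cut into pieces before the cut, joined by single edges after it.
    transfer : ∀ {j u y} → Star (Link (splice i P s) j) u y → After y → ∀ {x} → After x →
               Star (Link (before P) j) x u → Star (Link (splice i Q s) j) x y
    transfer ε ay ax w = link-before Q s (before-transfer ax ay w)
    transfer ((k , e , p) ◅ v) ay ax w with splice-cases P s e
    ... | inj₁ (_ , e′)   = transfer v ay ax (w ◅◅ (k , e′ , p) ◅ ε)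
    ... | inj₂ (i≤k , e′) = link-before Q s (before-transfer ax (k , i≤k , ends-inc p) w) ◅◅
          (k , splice-after Q s e′ , p) ◅ transfer v ay (k , i≤k , ends-inc (sameEnds-sym p)) ε

    -- Being touched is not coded separately, because it shows in a nonzero degree.
    touched-frontier : ∀ {j v} → TouchedFrontier Q j v → TouchedFrontier P j v
    touched-frontier {j} (f , t) = f , deg-≢0 (before P) λ e →
      touched-≢0 (before Q) t (trans (sym (same-degree j f)) e)

    touched-frontier′ : ∀ {j v} → TouchedFrontier P j v → TouchedFrontier Q j v
    touched-frontier′ {j} (f , t) = f , deg-≢0 (before Q) λ e →
      touched-≢0 (before P) t (trans (same-degree j f) e)

    touched-splice : ∀ {R t j v} → Touched (before R) j v → Touched (splice i R t) j v
    touched-splice {R} {t} (k , e , p) = k , splice-before R t e , p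

    -- If every component before the cut reaches the frontier, walks of P transfer between frontier vertices.
    via-frontier : ∀ j → (∀ x → Touched (before Q) j x → ∃ λ f → TouchedFrontier Q j f × Star (Link (before Q) j) x f) →
                   Connected (splice i Q s) j
    via-frontier j reach x y tx ty =
      let x′ , ax , tx′ , wx = anchor tx ; y′ , ay , ty′ , wy = anchor ty in
      wx ◅◅ transfer (G.connected j x′ y′ tx′ ty′) ay ax ε ◅◅ Star.reverse link-sym wy
      where
      anchor : ∀ {x} → Touched (splice i Q s) j x →
               ∃ λ x′ → After x′ × Touched (splice i P s) j x′ × Star (Link (splice i Q s) j) x x′
      anchor {x} (k , e , p) with splice-cases Q s e
      ... | inj₂ (i≤k , e′) = x , (k , i≤k , p) , (k , splice-after P s e′ , p) , ε
      ... | inj₁ (_ , e′)   = let f , tf , w = reach x (k , e′ , p) in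
            f , proj₂ (proj₁ tf) , touched-splice (proj₂ (touched-frontier tf)) , link-before Q s w

    connected : ∀ j → Connected (splice i Q s) j
    connected j with any? (λ f → frontier? f ×-dec touched? (before Q) j f)
    -- The completion of `Q` connects `x` to `f`. Its walk either meets a touched frontier vertex or
    -- stays before the cut as far as `f`.
    ... | yes (f , ff , tf) = via-frontier j λ x tx →
          case walk Q s′ (G′.connected j x f (touched-splice tx) (touched-splice tf)) tx of λ
          { (inj₁ r) → r ; (inj₂ (_ , w)) → f , (ff , tf) , w }
    ... | no unreached with any? (λ k → before Q k ≟ suc j)
    -- The colour does not occur before the cut, so there is no component to reach from.
    ...   | no unused = via-frontier j λ x (k , e , _) → contradiction (k , e) unused
    -- The colour occurs before the cut but at no frontier vertex, in `Q` and by `same-used` also in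
    -- `P`. Hence `s` cannot use it again, and the completion of `Q` supplies the walk.
    ...   | yes used  = λ x y tx ty → case walk Q s′
              (G′.connected j x y (touched-splice (only-before tx)) (touched-splice (only-before ty))) (only-before tx) of λ
              { (inj₁ (f , tf , _)) → contradiction (f , tf) unreached
              ; (inj₂ (_ , w)) → link-before Q s w }
      where
      k₀ : Fin m
      k₀ = proj₁ (same-used j used)
      t₀ : Touched (before P) j (src k₀)
      t₀ = k₀ , proj₂ (same-used j used) , inj₁ refl

      -- A later edge of the colour would be joined to `k₀` in the completed `P`, by a walk that
      -- passes through or ends at a touched frontier vertex.
      no-later : ∀ k → ¬ (i ≤ toℕ k × after s k ≡ suc j)
      no-later k (i≤k , e) = case walk P s
        (G.connected j (src k₀) (src k) (touched-splice t₀) (k , splice-after P s e , inj₁ refl)) t₀ of λ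
        { (inj₁ (f , tf , _)) → unreached (f , touched-frontier′ tf)
        ; (inj₂ (t , _)) → unreached (src k , touched-frontier′ ((touched-before P t , k , i≤k , inj₁ refl) , t)) }

      only-before : ∀ {x} → Touched (splice i Q s) j x → Touched (before Q) j x
      only-before (k , e , p) with splice-cases Q s e
      ... | inj₁ (_ , e′) = k , e′ , p
      ... | inj₂ later    = contradiction later (no-later k)

    Good-transfer : Good (splice i Q s)
    Good-transfer = record { specials = specials ; allowed = allowed ; connected = connected }

-- For every colour, the degrees, the components and whether the colour occurs at all; then the
-- numbers of special vertices passed. The extra code is for the prefixes without a completion.
codeSize : ℕ → ℕ
codeSize w = suc ((4 ^ w * (suc w ^ w * 2)) ^ 2 * 4 ^ 3)

-- The logarithm, factor by factor: `2 * w` for the degrees, `suc ⌊log₂ w ⌋ * w` for the components,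
-- `1` for the flag, all doubled for two colours; `6` for three counts below 4; and one bit for the
-- extra code.
codeBits : ℕ → ℕ
codeBits w = suc ((2 * w + (suc ⌊log₂ w ⌋ * w + 1)) * 2 + 6)

codeSize-≤ : ∀ {v w} → v ≤ w → codeSize v ≤ 2 ^ codeBits w
codeSize-≤ {v} {w} v≤w = begin
  suc (X ^ 2 * 4 ^ 3)          ≤⟨ ℕ.+-mono-≤ (ℕ.m^n>0 2 (x * 2 + 6)) bound ⟩
  2 ^ (x * 2 + 6) + 2 ^ (x * 2 + 6) ≡⟨ cong (2 ^ (x * 2 + 6) +_) (sym (ℕ.+-identityʳ _)) ⟩
  2 ^ codeBits w               ∎
  where
  open ℕ.≤-Reasoning
  l X x : ℕ
  l = suc ⌊log₂ w ⌋
  X = 4 ^ v * (suc v ^ v * 2)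
  x = 2 * w + (l * w + 1)

  -- Strictness matters: component codes range over `suc v` values, and `suc v` must still be at
  -- most `2 ^ l`.
  w<2^l : w < 2 ^ l
  w<2^l = ℕ.≰⇒> λ 2^l≤w → ℕ.<-irrefl refl
    (subst (_≤ ⌊log₂ w ⌋) (⌊log₂[2^n]⌋≡n l) (⌊log₂⌋-mono-≤ 2^l≤w))

  degrees : 4 ^ v ≤ 2 ^ (2 * w)
  degrees = subst (4 ^ v ≤_) (ℕ.^-*-assoc 2 2 w) (ℕ.^-monoʳ-≤ 4 v≤w)

  components : suc v ^ v ≤ 2 ^ (l * w)
  components = subst (suc v ^ v ≤_) (ℕ.^-*-assoc 2 l w)
    (ℕ.≤-trans (ℕ.^-monoˡ-≤ v (ℕ.≤-trans (s≤s v≤w) w<2^l)) (ℕ.^-monoʳ-≤ (2 ^ l) ⦃ ℕ.m^n≢0 2 l ⦄ v≤w))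

  X≤ : X ≤ 2 ^ x
  X≤ = begin
    X                                 ≤⟨ ℕ.*-mono-≤ degrees (ℕ.*-mono-≤ components (ℕ.≤-refl {2})) ⟩
    2 ^ (2 * w) * (2 ^ (l * w) * 2 ^ 1) ≡⟨ cong (2 ^ (2 * w) *_) (sym (ℕ.^-distribˡ-+-* 2 (l * w) 1)) ⟩
    2 ^ (2 * w) * 2 ^ (l * w + 1)     ≡⟨ sym (ℕ.^-distribˡ-+-* 2 (2 * w) (l * w + 1)) ⟩
    2 ^ x                             ∎

  bound : X ^ 2 * 4 ^ 3 ≤ 2 ^ (x * 2 + 6)
  bound = begin
    X ^ 2 * 2 ^ 6       ≤⟨ ℕ.*-monoˡ-≤ (2 ^ 6) (ℕ.^-monoˡ-≤ 2 X≤) ⟩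
    (2 ^ x) ^ 2 * 2 ^ 6 ≡⟨ cong (_* 2 ^ 6) (ℕ.^-*-assoc 2 x 2) ⟩
    2 ^ (x * 2) * 2 ^ 6 ≡⟨ sym (ℕ.^-distribˡ-+-* 2 (x * 2) 6) ⟩
    2 ^ (x * 2 + 6)     ∎

-- The exponent expands to `9 + 6 * n + 2 * (n * l)`. From `n = 2` on the logarithm is at least 1,
-- so 1 and `n` are at most `n * l`, and `17 = 9 + 6 + 2`.
codeBits∈O : codeBits ∈O (λ w → w * ⌊log₂ w ⌋)
codeBits∈O = 17 , 2 , λ n 2≤n → bound n ⌊log₂ n ⌋ 2≤n (⌊log₂⌋-mono-≤ {2} 2≤n)
  where
  open ℕ.≤-Reasoning
  open +-*-Solver
  bound : ∀ n l → 2 ≤ n → 1 ≤ l → suc ((2 * n + (suc l * n + 1)) * 2 + 6) ≤ 17 * (n * l)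
  bound n l 2≤n 1≤l = begin
    suc ((2 * n + (suc l * n + 1)) * 2 + 6)
      ≡⟨ solve 2 (λ n l → con 1 :+ ((con 2 :* n :+ ((con 1 :+ l) :* n :+ con 1)) :* con 2 :+ con 6)
                   := con 9 :* con 1 :+ con 6 :* n :+ con 2 :* (n :* l)) refl n l ⟩
    9 * 1 + 6 * n + 2 * (n * l)
      ≤⟨ ℕ.+-monoˡ-≤ (2 * (n * l)) (ℕ.+-mono-≤ (ℕ.*-monoʳ-≤ 9 (ℕ.≤-trans (ℕ.<⇒≤ 2≤n) n≤nl)) (ℕ.*-monoʳ-≤ 6 n≤nl)) ⟩
    9 * (n * l) + 6 * (n * l) + 2 * (n * l)
      ≡⟨ solve 1 (λ x → con 9 :* x :+ con 6 :* x :+ con 2 :* x := con 17 :* x) refl (n * l) ⟩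
    17 * (n * l) ∎
    where
    n≤nl : n ≤ n * l
    n≤nl = subst (_≤ n * l) (ℕ.*-identityʳ n) (ℕ.*-monoʳ-≤ n 1≤l)

-- Coding the state at the frontier

module Code {n m : ℕ} (src tgt : Fin m → Fin n) (i : ℕ) where
  open EdgeList src tgt
  open Cut src tgt i

  frontierSize : ℕ
  frontierSize = count λ v → ⌊ frontier? v ⌋

  private
    W : ℕ
    W = frontierSize
    module F = Enumeration (enumerate (λ v → ⌊ frontier? v ⌋))

  -- A component is named by the position of a frontier vertex in it, not by its label, so the range
  -- depends on the frontier only. The default `zero` never arises for the label of a frontier
  -- vertex, by `component-lab`.
  component : Choice → Fin 2 → Fin n → Fin (suc W)
  component P j ℓ with any? (λ q → Labelling.lab (labels (before P) j) (F.at q) ≟ ℓ)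
  ... | yes (q , _) = suc q
  ... | no _        = zero

  componentOf : Choice → Fin 2 → Fin W → Fin (suc W)
  componentOf P j p = component P j (Labelling.lab (labels (before P) j) (F.at p))

  component-lab : ∀ P j p → ∃ λ q → componentOf P j p ≡ suc q ×
    Labelling.lab (labels (before P) j) (F.at q) ≡ Labelling.lab (labels (before P) j) (F.at p)
  component-lab P j p with any? (λ q → Labelling.lab (labels (before P) j) (F.at q) ≟
                                       Labelling.lab (labels (before P) j) (F.at p))
  ... | yes (q , e) = q , refl , e
  ... | no none     = contradiction (p , refl) none

  componentOf-injective : ∀ P j p q → componentOf P j p ≡ componentOf P j q →
                          Star (Link (before P) j) (F.at p) (F.at q)
  componentOf-injective P j p q e with component-lab P j p | component-lab P j q
  ... | r , ep , lp | r′ , eq , lq = ⇒ (Labelling.lab⇔ (labels (before P) j) _ _)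
    (trans (sym lp) (trans (cong (Labelling.lab (labels (before P) j) ∘ F.at) r≡r′) lq))
    where
    r≡r′ : r ≡ r′
    r≡r′ = suc-injective (trans (sym ep) (trans e eq))

  used? : ∀ P j → Dec (∃ λ k → before P k ≡ suc j)
  used? P j = any? λ k → before P k ≟ suc j

  flag : ∀ {X : Set} → Dec X → Fin 2
  flag (yes _) = suc zero
  flag (no _)  = zero

  flag-yes : ∀ {X Y : Set} (X? : Dec X) (Y? : Dec Y) → flag X? ≡ flag Y? → Y → X
  flag-yes (yes x) _       _ _ = x
  flag-yes (no _)  (no ¬y) _ y = contradiction y ¬y

  live? : ∀ P → Dec (Live P)
  live? P = map′ (λ (x , g) → finToFun x , g)
    (λ (s , g) → funToFin s , Good-cong (splice-congʳ i P (sym ∘ finToFun-funToFin s)) g)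
    (any? λ x → good? (splice i P (finToFun x)))

  -- Reduction modulo 4 loses nothing for completable prefixes, whose degrees are at most 3; the
  -- others do not use this code.
  degreeCode : Choice → Fin 2 → Fin (4 ^ W)
  degreeCode P j = funToFin λ p → deg (before P) j (F.at p) mod 4

  colourCode : Choice → Fin 2 → Fin (4 ^ W * (suc W ^ W * 2))
  colourCode P j = combine (degreeCode P j) (combine (funToFin (componentOf P j)) (flag (used? P j)))

  doneCode : Choice → Fin (4 ^ 3)
  doneCode P = funToFin λ t → count (done P t) mod 4

  stateCode : Choice → Fin ((4 ^ W * (suc W ^ W * 2)) ^ 2 * 4 ^ 3)
  stateCode P = combine (funToFin (colourCode P)) (doneCode P)

  codeIf : ∀ P → Dec (Live P) → Fin (codeSize W)
  codeIf P (yes _) = suc (stateCode P)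
  codeIf P (no _)  = zero

  code : Choice → Fin (codeSize W)
  code P = codeIf P (live? P)

  deg-≤3 : ∀ {s} → Good s → ∀ j v → deg s j v ≤ 3
  deg-≤3 {s} g j v = bound j (Good.allowed g v)
    where
    small : ∀ {k} → k ≤ 3 → ∀ {d} → d ≡ k → d ≤ 3
    small k≤3 refl = k≤3
    bound : ∀ j → degree s v ≡ replicate 2 0 ⊎ Allowed (degree s v) → deg s j v ≤ 3
    bound zero       (inj₁ e)                           = small z≤n (first-entry e)
    bound (suc zero) (inj₁ e)                           = small z≤n (second-entry e)
    bound zero       (inj₂ (inj₁ (zero , e)))           = small (ℕ.≤ᵇ⇒≤ 3 3 tt) (first-entry e)
    bound (suc zero) (inj₂ (inj₁ (zero , e)))           = small z≤n (second-entry e)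
    bound zero       (inj₂ (inj₁ (suc zero , e)))       = small (ℕ.≤ᵇ⇒≤ 1 3 tt) (first-entry e)
    bound (suc zero) (inj₂ (inj₁ (suc zero , e)))       = small (ℕ.≤ᵇ⇒≤ 2 3 tt) (second-entry e)
    bound zero       (inj₂ (inj₁ (suc (suc zero) , e))) = small (ℕ.≤ᵇ⇒≤ 1 3 tt) (first-entry e)
    bound (suc zero) (inj₂ (inj₁ (suc (suc zero) , e))) = small (ℕ.≤ᵇ⇒≤ 1 3 tt) (second-entry e)
    bound zero       (inj₂ (inj₂ (zero , e)))           = small (ℕ.≤ᵇ⇒≤ 2 3 tt) (first-entry e)
    bound (suc zero) (inj₂ (inj₂ (zero , e)))           = small z≤n (second-entry e)
    bound zero       (inj₂ (inj₂ (suc zero , e)))       = small z≤n (first-entry e)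
    bound (suc zero) (inj₂ (inj₂ (suc zero , e)))       = small (ℕ.≤ᵇ⇒≤ 2 3 tt) (second-entry e)

  -- A completion can only add to a degree, and its own degrees are at most 3.
  live-degree : ∀ {P} → Live P → ∀ j v → deg (before P) j v < 4
  live-degree {P} (s , g) j v = s≤s (ℕ.≤-trans
    (ℕ.≤-trans (ℕ.m≤m+n _ (deg (after s) j v)) (ℕ.≤-reflexive (sym (deg-splice P s j v)))) (deg-≤3 g j v))

  live-done : ∀ {P} → Live P → ∀ t → count (done P t) < 4
  live-done {P} (s , g) t = s≤s (ℕ.≤-trans (ℕ.m≤m+n _ (count (pending P s t)))
    (ℕ.≤-trans (ℕ.≤-reflexive (trans (sym (count-done-pending P s t)) (Good.specials g t))) (multiplicity-≤3 t)))
    where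
    multiplicity-≤3 : ∀ t → multiplicity t ≤ 3
    multiplicity-≤3 zero             = s≤s z≤n
    multiplicity-≤3 (suc zero)       = s≤s z≤n
    multiplicity-≤3 (suc (suc zero)) = s≤s (s≤s z≤n)

  sameState : ∀ {P Q} → Live P → Live Q → stateCode P ≡ stateCode Q → SameState P Q
  sameState {P} {Q} lP lQ eq = record
    { same-degree = λ j {v} f → subst (λ v → deg (before P) j v ≡ deg (before Q) j v) (at-index v f)
        (mod-injective (live-degree lP j _) (live-degree lQ j _)
          (funToFin-injective {f = λ p → deg (before P) j (F.at p) mod 4} (degree-eq j) (index v f)))
    ; same-done   = λ t → mod-injective (live-done lP t) (live-done lQ t)
        (funToFin-injective {f = λ t → count (done P t) mod 4} {λ t → count (done Q t) mod 4} done-eq t)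
    ; same-used   = λ j → flag-yes (used? P j) (used? Q j) (flag-eq j)
    -- Connected vertices have equal labels and hence equal codes in `P`; the same codes in `Q` give
    -- equal labels there.
    ; same-comp   = λ j {u} {v} fu fv w → subst₂ (Star (Link (before Q) j)) (at-index u fu) (at-index v fv)
        (componentOf-injective Q j _ _ (trans (sym (component-eq j (index u fu))) (trans
          (cong (component P j) (⇐ (Labelling.lab⇔ (labels (before P) j) _ _)
             (subst₂ (Star (Link (before P) j)) (sym (at-index u fu)) (sym (at-index v fv)) w)))
          (component-eq j (index v fv)))))
    ; live        = lQ
    }
    where
    index : ∀ v → Frontier v → Fin W
    index v f = F.index v (fromWitness f)
    at-index : ∀ v f → F.at (index v f) ≡ v
    at-index v f = F.at-index v (fromWitness f)

    split₁ : funToFin (colourCode P) ≡ funToFin (colourCode Q) × doneCode P ≡ doneCode Q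
    split₁ = combine-injective _ _ _ _ eq
    done-eq : doneCode P ≡ doneCode Q
    done-eq = proj₂ split₁
    split₂ : ∀ j → degreeCode P j ≡ degreeCode Q j ×
                   combine (funToFin (componentOf P j)) (flag (used? P j)) ≡
                   combine (funToFin (componentOf Q j)) (flag (used? Q j))
    split₂ j = combine-injective _ _ _ _ (funToFin-injective {f = colourCode P} {colourCode Q} (proj₁ split₁) j)
    degree-eq : ∀ j → degreeCode P j ≡ degreeCode Q j
    degree-eq j = proj₁ (split₂ j)
    split₃ : ∀ j → funToFin (componentOf P j) ≡ funToFin (componentOf Q j) × flag (used? P j) ≡ flag (used? Q j)
    split₃ j = combine-injective _ _ _ _ (proj₂ (split₂ j))
    component-eq : ∀ j → componentOf P j ≗ componentOf Q j
    component-eq j = funToFin-injective {f = componentOf P j} (proj₁ (split₃ j))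
    flag-eq : ∀ j → flag (used? P j) ≡ flag (used? Q j)
    flag-eq j = proj₂ (split₃ j)

  -- Prefixes without a completion can share a code, as they accept nothing. For the others the
  -- transfer is applied in both directions.
  code-sound : ∀ {P Q} → code P ≡ code Q → ∀ s → ⌊ good? (splice i P s) ⌋ ≡ ⌊ good? (splice i Q s) ⌋
  code-sound {P} {Q} eq s = by-cases (live? P) (live? Q) eq
    where
    by-cases : (d : Dec (Live P)) (d′ : Dec (Live Q)) → codeIf P d ≡ codeIf Q d′ →
               ⌊ good? (splice i P s) ⌋ ≡ ⌊ good? (splice i Q s) ⌋
    by-cases (yes lP) (yes lQ) eq = T-ext
      (λ g → fromWitness (Good-transfer (sameState lP lQ (suc-injective eq)) s (toWitness g)))
      (λ g → fromWitness (Good-transfer (sameState lQ lP (sym (suc-injective eq))) s (toWitness g)))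
    by-cases (no ¬lP) (no ¬lQ) eq = T-ext
      (λ g → contradiction (s , toWitness g) ¬lP) (λ g → contradiction (s , toWitness g) ¬lQ)

-- The host graph

lookup-injective : ∀ {A : Set} {xs : List A} → Unique xs → ∀ p q → lookup xs p ≡ lookup xs q → p ≡ q
lookup-injective (x∉ ∷ u) zero    zero    e = refl
lookup-injective (x∉ ∷ u) zero    (suc q) e = contradiction e (All.lookup x∉ (∈-lookup q))
lookup-injective (x∉ ∷ u) (suc p) zero    e = contradiction (sym e) (All.lookup x∉ (∈-lookup p))
lookup-injective (x∉ ∷ u) (suc p) (suc q) e = cong suc (lookup-injective u p q e)

-- Isolated vertices are tolerated: they are not vertices of the subgraph induced by the edges.
record EdgeProfile (Fᶜ : ColouredGraph 2) : Set where
  field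
    specials  : ∀ t → count (λ v → ⌊ colouredDegree Fᶜ v ≟ᵈ special t ⌋) ≡ multiplicity t
    allowed   : ∀ v → colouredDegree Fᶜ v ≡ replicate 2 0 ⊎ Allowed (colouredDegree Fᶜ v)
    connected : ∀ i → ColourConnected Fᶜ i

0-not-allowed : ¬ Allowed (replicate 2 0)
0-not-allowed (inj₁ (zero , ()))
0-not-allowed (inj₁ (suc zero , ()))
0-not-allowed (inj₁ (suc (suc zero) , ()))
0-not-allowed (inj₂ (zero , ()))
0-not-allowed (inj₂ (suc zero , ()))

-- The discarded vertices have degree `(0,0)`, which is neither special nor in `Δ 2`, and no walk
-- between touched vertices visits them.
Profile-edgeInduced : ∀ Fᶜ → Profile (edgeInduced Fᶜ) ⇔ EdgeProfile Fᶜ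
Profile-edgeInduced Fᶜ = mk⇔ forth back
  where
  open ColouredGraph Fᶜ

  touched? : ∀ u → Dec (∃ λ i → ∃ λ v → E Fᶜ i u v)
  touched? u = any? λ i → any? λ v → T? (edge i u v)

  L : List (Fin order)
  L = filter touched? (allFin order)

  I : ColouredGraph 2
  I = edgeInduced Fᶜ

  h : Fin (length L) → Fin order
  h = lookup L

  h-injective : ∀ {p q} → h p ≡ h q → p ≡ q
  h-injective = lookup-injective (filter⁺ touched? (allFin⁺ order)) _ _

  h-touched : ∀ p → ∃ λ i → ∃ λ v → E Fᶜ i (h p) v
  h-touched p = proj₂ (∈-filter⁻ touched? {xs = allFin order} (∈-lookup p))

  preimage : ∀ u → (∃ λ i → ∃ λ v → E Fᶜ i u v) → ∃ λ p → h p ≡ u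
  preimage u t = Any.index u∈L , sym (lookup-index u∈L)
    where
    u∈L : u ∈ˡ L
    u∈L = ∈-filter⁺ touched? (∈-allFin u) t

  degree : ∀ p → colouredDegree I p ≡ colouredDegree Fᶜ (h p)
  degree p = tabulate-cong λ i → count-⤖ {f = ColouredGraph.edge I i p} {g = edge i (h p)} h (λ _ e → e) (λ _ _ → h-injective)
    λ v e → let q , eq = preimage v (i , h p , symm i _ _ e) in q , subst (E Fᶜ i (h p)) (sym eq) e , eq

  isolated : ∀ v → ¬ (∃ λ i → ∃ λ w → E Fᶜ i v w) → colouredDegree Fᶜ v ≡ replicate 2 0
  isolated v ¬t = cong₂ (λ m n → m ∷ n ∷ []) (count-none (edge zero v) λ w e → ¬t (zero , w , e))
                                             (count-none (edge (suc zero) v) λ w e → ¬t (suc zero , w , e))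

  allowed-touched : ∀ v → Allowed (colouredDegree Fᶜ v) → ∃ λ i → ∃ λ w → E Fᶜ i v w
  allowed-touched v a with touched? v
  ... | yes t = t
  ... | no ¬t = contradiction (subst Allowed (isolated v ¬t) a) 0-not-allowed

  specials-same : ∀ t → count (λ p → ⌊ colouredDegree I p ≟ᵈ special t ⌋) ≡
                        count (λ v → ⌊ colouredDegree Fᶜ v ≟ᵈ special t ⌋)
  specials-same t = count-⤖ h (λ p e → fromWitness (trans (sym (degree p)) (toWitness e)))
    (λ _ _ → h-injective)
    λ v e → let p , eq = preimage v (allowed-touched v (inj₁ (t , toWitness e))) in
      p , fromWitness (trans (degree p) (trans (cong (colouredDegree Fᶜ) eq) (toWitness e))) , eq

  lift : ∀ {i u v} → Star (E Fᶜ i) u v → ∀ p q → h p ≡ u → h q ≡ v → Star (E I i) p q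
  lift ε p q eq eq′ rewrite h-injective {p} {q} (trans eq (sym eq′)) = ε
  lift {i} (_◅_ {j = w} e s) p q refl eq′ =
    let r , eq = preimage w (i , _ , symm i _ _ e) in subst (E Fᶜ i (h p)) (sym eq) e ◅ lift s r q eq eq′

  forth : Profile I → EdgeProfile Fᶜ
  forth prof = record
    { specials  = λ t → trans (sym (specials-same t)) (specials t)
    ; allowed   = λ v → case touched? v of λ
        { (yes t) → let p , eq = preimage v t in
            inj₂ (subst (λ w → Allowed (colouredDegree Fᶜ w)) eq (subst Allowed (degree p) (allowed p)))
        ; (no ¬t) → inj₁ (isolated v ¬t) }
    ; connected = conn
    }
    where
    open Profile prof
    conn : ∀ i → ColourConnected Fᶜ i
    conn i u v (u′ , e) (v′ , e′) with preimage u (i , u′ , e) | preimage v (i , v′ , e′)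
                                    | preimage u′ (i , u , symm i _ _ e) | preimage v′ (i , v , symm i _ _ e′)
    ... | p , refl | q , refl | p′ , refl | q′ , refl =
      Star.gmap h (λ e → e) (connected i p q (p′ , e) (q′ , e′))

  back : EdgeProfile Fᶜ → Profile I
  back prof = record
    { specials  = λ t → trans (specials-same t) (specials t)
    ; allowed   = λ p → subst Allowed (sym (degree p)) ([ zero-degree p , id ]′ (allowed (h p)))
    ; connected = λ i p q (p′ , e) (q′ , e′) → lift (connected i (h p) (h q) (h p′ , e) (h q′ , e′)) p q refl refl
    }
    where
    open EdgeProfile prof
    zero-degree : ∀ p → colouredDegree Fᶜ (h p) ≡ replicate 2 0 → Allowed (colouredDegree Fᶜ (h p))
    zero-degree p eq with h-touched p
    ... | zero , v , e     = contradiction e (size-0 (sized (first-entry eq)) v)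
    ... | suc zero , v , e = contradiction e (size-0 (sized (second-entry eq)) v)

module _ (G : Graph) {m : ℕ} (e : EdgeOrder G m) where
  private
    src tgt : Fin m → Vertex G
    src k = proj₁ (proj₁ (Inverse.to e k))
    tgt k = proj₂ (proj₁ (Inverse.to e k))

  open EdgeList src tgt

  module _ (D : ColouredSubset 2 m) where
    open ColouredSubset D

    edge? : ∀ i u v → Dec (∃ λ k → k ∈ part i × Joins G e k u v)
    edge? i u v = any? λ k → k ∈? part i ×-dec joins? G e k u v

    -- This is the graph inside `colouredSubgraph` before `edgeInduced` is applied, written out so
    -- that it has a name.
    hostGraph : ColouredGraph 2
    hostGraph = record
      { order    = Graph.order G
      ; edge     = λ i u v → ⌊ edge? i u v ⌋
      ; irrefl   = λ i u p → let k , _ , q = toWitness {a? = edge? i u u} p in joins-irrefl G e k u q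
      ; symm     = λ i u v p → let k , d , q = toWitness {a? = edge? i u v} p in
          fromWitness {a? = edge? i v u} (k , d , sameEnds-sym q)
      ; disjoint = λ i j u v p q →
          let k , d , s = toWitness {a? = edge? i u v} p
              l , d′ , t = toWitness {a? = edge? j u v} q
          in disjoint (subst (_∈ part i) (joins-injective G e k l u v s t) d) d′
      }

    private
      s : Choice
      s = assignment D

    edge⇔link : ∀ j u v → E hostGraph j u v ⇔ Link s j u v
    edge⇔link j u v = mk⇔
      (λ t → let k , d , p = toWitness {a? = edge? j u v} t in k , ⇐ (assignment⇔ D j k) d , p)
      (λ (k , d , p) → fromWitness {a? = edge? j u v} (k , ⇒ (assignment⇔ D j k) d , p))

    otherEnd : Vertex G → Fin m → Vertex G
    otherEnd v k = if ⌊ v ≟ src k ⌋ then tgt k else src k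

    joins-otherEnd : ∀ {v k} → Inc v k → Joins G e k v (otherEnd v k)
    joins-otherEnd {v} {k} p with v ≟ src k
    ... | yes v≡ = inj₁ (v≡ , refl)
    ... | no v≢  = [ (λ v≡ → contradiction v≡ v≢) , (λ v≡ → inj₂ (v≡ , refl)) ]′ p

    otherEnd-joins : ∀ {v u k} → Joins G e k v u → otherEnd v k ≡ u
    otherEnd-joins {v} {u} {k} p with v ≟ src k
    ... | no v≢  = [ (λ (v≡ , _) → contradiction v≡ v≢) , (λ (_ , u≡) → sym u≡) ]′ p
    ... | yes v≡ = [ (λ (_ , u≡) → sym u≡) ,
                     (λ (v≡′ , _) → contradiction (inj₁ (v≡ , v≡′)) (joins-irrefl G e k v)) ]′ p

    -- `otherEnd v` matches the chosen edges at `v` with its neighbours, because distinct edges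
    -- never join the same pair.
    degree-host : ∀ v → colouredDegree hostGraph v ≡ degree s v
    degree-host v = tabulate-cong λ j → sym (count-⤖ {f = λ k → ⌊ s k ≟ suc j ×-dec inc? v k ⌋}
      {g = ColouredGraph.edge hostGraph j v} (otherEnd v)
      (λ k t → let d , p = ⇒ (counted⇔ s j v k) t in ⇐ (edge⇔link j v (otherEnd v k)) (k , d , joins-otherEnd p))
      (λ {k} {l} t t′ eq → joins-injective G e k l v (otherEnd v k)
        (joins-otherEnd (proj₂ (⇒ (counted⇔ s j v k) t)))
        (subst (Joins G e l v) (sym eq) (joins-otherEnd (proj₂ (⇒ (counted⇔ s j v l) t′)))))
      (λ u t → let k , d , p = ⇒ (edge⇔link j v u) t in k , ⇐ (counted⇔ s j v k) (d , inc p) , otherEnd-joins p))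
      where
      inc : ∀ {k u} → Joins G e k v u → Inc v k
      inc (inj₁ (p , _)) = inj₁ p
      inc (inj₂ (p , _)) = inj₂ p

    EdgeProfile⇔Good : EdgeProfile hostGraph ⇔ Good s
    EdgeProfile⇔Good = mk⇔
      (λ p → let open EdgeProfile p in record
        { specials  = λ t → trans (sym (specials-same t)) (specials t)
        ; allowed   = λ v → subst (λ d → d ≡ replicate 2 0 ⊎ Allowed d) (degree-host v) (allowed v)
        ; connected = λ j u v tu tv → Star.map (λ {x} {y} → ⇒ (edge⇔link j x y)) (connected j u v (touched tu) (touched tv))
        })
      (λ g → let open Good g in record
        { specials  = λ t → trans (specials-same t) (specials t)
        ; allowed   = λ v → subst (λ d → d ≡ replicate 2 0 ⊎ Allowed d) (sym (degree-host v)) (allowed v)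
        ; connected = λ j u v tu tv → Star.map (λ {x} {y} → ⇐ (edge⇔link j x y)) (connected j u v (touched′ tu) (touched′ tv))
        })
      where
      specials-same : ∀ t → count (λ v → ⌊ colouredDegree hostGraph v ≟ᵈ special t ⌋) ≡
                            count (λ v → ⌊ degree s v ≟ᵈ special t ⌋)
      specials-same t = count-≗ λ v → cong (λ d → ⌊ d ≟ᵈ special t ⌋) (degree-host v)

      touched : ∀ {j v} → Touched s j v → ∃ (E hostGraph j v)
      touched {j} {v} (k , d , p) = otherEnd v k , ⇐ (edge⇔link j v _) (k , d , joins-otherEnd p)

      touched′ : ∀ {j v} → ∃ (E hostGraph j v) → Touched s j v
      touched′ {j} {v} (u , t) with ⇒ (edge⇔link j v u) t
      ... | k , d , inj₁ (p , _) = k , d , inj₁ p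
      ... | k , d , inj₂ (p , _) = k , d , inj₂ p

    colouredSubgraph≡ : colouredSubgraph G e D ≡ edgeInduced hostGraph
    colouredSubgraph≡ = refl

    𝒞*⇔Good : 𝒞* M (colouredSubgraph G e D) ⇔ Good s
    𝒞*⇔Good = mk⇔
      (λ h → ⇒ EdgeProfile⇔Good (⇒ (Profile-edgeInduced hostGraph)
        (⇒ (𝒞*⇔Profile (edgeInduced hostGraph)) (subst (𝒞* M) colouredSubgraph≡ h))))
      (λ g → subst (𝒞* M) (sym colouredSubgraph≡) (⇐ (𝒞*⇔Profile (edgeInduced hostGraph))
        (⇐ (Profile-edgeInduced hostGraph) (⇐ EdgeProfile⇔Good g))))

no-edges-not-Good : ∀ {n} (src tgt : Fin 0 → Fin n) s → ¬ EdgeList.Good src tgt s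
no-edges-not-Good src tgt s g = case trans (sym (EdgeList.Good.specials g zero))
  (count-none (λ v → ⌊ EdgeList.degree src tgt s v ≟ᵈ special zero ⌋) λ v ()) of λ ()

-- Without edges there are no labels, hence no inner nodes. The family is empty, as a vertex of
-- degree `(3,0)` is missing, so the root is `⊥ₙ`.
emptyDiagram : ∀ {c} → DD c 0
emptyDiagram = record
  { size        = 0
  ; label       = λ ()
  ; arc         = λ ()
  ; root        = ⊥ₙ
  ; arc-label   = λ { {()} }
  ; root-unique = λ ()
  }

diagramOf : (G : Graph) {m : ℕ} (e : EdgeOrder G m) →
            ∃ λ (Z : DD 2 m) → Represents Z (λ D → 𝒞* M (colouredSubgraph G e D)) ×
                               DD.width Z ≤ 2 ^ codeBits (maxFrontierSize G e)
diagramOf G {zero} e = emptyDiagram ,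
  (λ D → mk⇔ (λ h → contradiction (⇒ (𝒞*⇔Good G e D) h) (no-edges-not-Good _ _ _)) (λ { (() , _) })) , z≤n
diagramOf G {suc m} e = N.diagram ,
  (λ D → mk⇔ (⇒ (N.represents D) ∘ fromWitness ∘ ⇒ (𝒞*⇔Good G e D))
             (⇐ (𝒞*⇔Good G e D) ∘ toWitness ∘ ⇐ (N.represents D))) ,
  N.width-≤ (λ i → codeSize (Code.frontierSize src tgt (toℕ i))) (λ i → Code.code src tgt (toℕ i))
    (λ i → Code.code-sound src tgt (toℕ i)) (λ i → codeSize-≤ (frontier-≤ i))
  where
  src tgt : Fin (suc m) → Vertex G
  src k = proj₁ (proj₁ (Inverse.to e k))
  tgt k = proj₂ (proj₁ (Inverse.to e k))
  open EdgeList src tgt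

  accept-cong : ∀ {s t : Choice} → s ≗ t → ⌊ good? s ⌋ ≡ ⌊ good? t ⌋
  accept-cong s≗t = T-ext (fromWitness ∘ Good-cong s≗t ∘ toWitness) (fromWitness ∘ Good-cong (sym ∘ s≗t) ∘ toWitness)

  module N = Nerode {2} {m} (λ s → ⌊ good? s ⌋) accept-cong

  -- The frontier of the cut and that of the host graph are definitionally the same.
  frontier-≤ : ∀ i → Code.frontierSize src tgt (toℕ i) ≤ maxFrontierSize G e
  frontier-≤ i = ℕ.≤-trans (ℕ.≤-reflexive {Code.frontierSize src tgt (toℕ i)} {∣ frontier G e i ∣} refl)
    (All.tabulate⁻ {f = id} (All.map⁻ {f = ∣_∣ ∘ frontier G e} (xs≤max 0 (map (∣_∣ ∘ frontier G e) (allFin (suc m))))) i)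

theorem7 : (∀ u v → Adj (complete 4) u v →
    IsExtendedProfile M (𝒮 (deleteEdge (complete 4) u v)))
    ×
    (∃ λ (f : ℕ → ℕ) → f ∈O (λ w → w * ⌊log₂ w ⌋) ×
    (∀ (G : Graph) {m : ℕ} (e : EdgeOrder G m) →
    ∃ λ (Z : DD 2 m) →
    Represents Z (λ D → 𝒞* M (colouredSubgraph G e D)) ×
    DD.width Z ≤ 2 ^ f (maxFrontierSize G e)))
theorem7 = extendedProfile , codeBits , codeBits∈O , diagramOf
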